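{- Let $G^\sigma$ be a connected oriented unicyclic graph of order $n$ whose unique cycle $C_k^\sigma$ has length $k$, and assume $sr(G^\sigma)=k$ if $k$ is even and $sr(G^\sigma)=k+1$ if $k$ is odd. (1) If there exists a vertex $v\in V(C_k^\sigma)$ which is saturated in $G^\sigma\{v\}$, then $G^\sigma\{v\}$ is an oriented star and $\beta(G^\sigma-G^\sigma\{v\})=\frac{k-2}{2}$ if $k$ is even, $=\frac{k-1}{2}$ if $k$ is odd (with no condition on the orientation). (2) If no vertex $v\in V(C_k^\sigma)$ is saturated in $G^\sigma\{v\}$, then: (a) if $k$ is odd, $G\cong U^*$ (with no condition on the orientation); (b) if $k$ is even, $G\cong U^*$ and $C_k^\sigma$ is evenly-oriented.
   Context: An oriented graph $G^\sigma$ is a simple graph $G$ (underlying graph) together with an orientation of each edge. Its skew-adjacency matrix $S(G^\sigma)=(s_{ij})$ has $s_{ij}=1$ if there is an arc from $v_i$ to $v_j$, $s_{ij}=-1$ if there is an arc from $v_j$ to $v_i$, and $0$ otherwise; the skew-rank $sr(G^\sigma)$ is its rank. For an even cycle $u_1\cdots u_ku_1$, its sign is the sign of $\prod_{i=1}^k s_{u_iu_{i+1}}$ ($u_{k+1}=u_1$); it is evenly-oriented if this sign is positive. For a vertex $v$ on the cycle, $G^\sigma\{v\}$ is the component containing $v$ of the graph obtained by deleting the cycle edges (a tree rooted at $v$). A vertex $v$ of a tree $T$ is saturated in $T$ if every maximum matching of $T$ covers $v$. $\beta(H)$ is the matching number. $U^*$ is the graph obtained from a cycle $C_k$ and a star $S_{n-k}$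 (on $n-k$ vertices) by adding an edge between a vertex of $C_k$ and the center of $S_{n-k}$.
   Formalization: Part (2)(b) is stated for n > k only: for n = k (G an even, oddly-oriented cycle, with sr = k and no saturated cycle vertex) U* is undefined, since the star on 0 vertices has no center, and the cycle is not evenly-oriented. -}

module Defs where

open import Data.Fin using (Fin; toℕ)
open import Data.Fin.Properties using (any?) renaming (_≟_ to _≟ᶠ_)
open import Data.Irrelevant using ([_])
open import Data.List using (List; length)
open import Data.List.Relation.Unary.All using (All)
open import Data.List.Relation.Unary.AllPairs using (AllPairs)
open import Data.List.Relation.Unary.Any using (Any)
open import Data.Nat using (ℕ; suc; _≤_)
open import Data.Nat.DivMod using (_mod_)
import Data.Nat.Properties as ℕ
open import Data.Product using (Σ-syntax; ∃-syntax; _×_; _,_; uncurry)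
open import Data.Rational using (ℚ; 0ℚ; 1ℚ; -_; _*_; _<_)
open import Data.Rational.Properties using (+-0-commutativeMonoid; *-1-commutativeMonoid)
open import Data.Refinement using (Refinement; value; _,_)
open import Data.Sum using (_⊎_; inj₁; inj₂; swap)
open import Function using (_∘_; _↔_; _⇔_; Injective; Inverse)
open import Level using (0ℓ)
open import Relation.Binary using (Rel; Decidable; Symmetric; Irreflexive)
open import Relation.Binary.Construct.Closure.ReflexiveTransitive using (Star; ε)
open import Relation.Binary.PropositionalEquality using (_≡_; _≢_; refl; cong; ≢-sym)
open import Relation.Nullary using (¬_; yes; no)
open import Relation.Nullary.Decidable using (¬?; _×-dec_; _⊎-dec_)
open import Relation.Unary using (Pred; ∁)

open import Algebra.Properties.CommutativeMonoid.Sum +-0-commutativeMonoid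
  using () renaming (sum to Σℚ)
open import Algebra.Properties.CommutativeMonoid.Sum *-1-commutativeMonoid
  using () renaming (sum to Πℚ)

private
  variable
    V W : Set
    k m n : ℕ

record Graph (V : Set) : Set₁ where
  field
    Adj    : Rel V 0ℓ
    adj?   : Decidable Adj
    symm   : Symmetric Adj
    irrefl : Irreflexive _≡_ Adj

open Graph public

infix 4 _≅_

record _≅_ (G : Graph V) (H : Graph W) : Set where
  field
    bijection : V ↔ W
    preserves : ∀ u v → Adj G u v ⇔ Adj H (Inverse.to bijection u) (Inverse.to bijection v)

Connected : Graph V → Set
Connected G = ∀ u v → Star (Adj G) u v

-- The proof that a vertex satisfies P is irrelevant, so that each vertex of G
-- satisfying P occurs exactly once in the induced subgraph.
induced : Graph V → (P : Pred V 0ℓ) → Graph (Refinement V P)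
induced G P = record
  { Adj    = λ u v → Adj G (value u) (value v)
  ; adj?   = λ u v → adj? G (value u) (value v)
  ; symm   = symm G
  ; irrefl = λ u≡v → irrefl G (cong value u≡v)
  }

record Matching (G : Graph V) : Set where
  field
    edges    : List (V × V)
    areEdges : All (uncurry (Adj G)) edges
    disjoint : AllPairs (λ (a , b) (c , d) → a ≢ c × a ≢ d × b ≢ c × b ≢ d) edges

open Matching public

size : {G : Graph V} → Matching G → ℕ
size M = length (edges M)

Covers : {G : Graph V} → Matching G → V → Set
Covers M v = Any (λ (a , b) → v ≡ a ⊎ v ≡ b) (edges M)

Maximum : {G : Graph V} → Matching G → Set
Maximum {G = G} M = (M′ : Matching G) → size M′ ≤ size M

MatchingNumber : Graph V → ℕ → Set
MatchingNumber G b = Σ[ M ∈ Matching G ] (Maximum M × size M ≡ b)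

Saturated : Graph V → V → Set
Saturated G v = (M : Matching G) → Maximum M → Covers M v

next : Fin k → Fin k
next {k = suc m} i = suc (toℕ i) mod suc m

record Cycle (G : Graph V) (k : ℕ) : Set where
  field
    3≤k       : 3 ≤ k
    vertex    : Fin k → V
    injective : Injective _≡_ _≡_ vertex
    adjacent  : ∀ i → Adj G (vertex i) (vertex (next i))

open Cycle public

OnCycle : {G : Graph V} → Cycle G k → Pred V 0ℓ
OnCycle C v = ∃[ i ] vertex C i ≡ v

CycleEdge : {G : Graph V} → Cycle G k → Rel V 0ℓ
CycleEdge C u v = ∃[ i ] ( (vertex C i ≡ u × vertex C (next i) ≡ v)
                         ⊎ (vertex C i ≡ v × vertex C (next i) ≡ u))

-- Every cycle of G is C up to the choice of starting point and direction.
IsUniqueCycle : {G : Graph V} → Cycle G k → Set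
IsUniqueCycle {G = G} C =
  ∀ {l} (D : Cycle G l) → ∀ u v → CycleEdge D u v ⇔ CycleEdge C u v

module _ {G : Graph (Fin n)} (C : Cycle G k) where

  cycleEdge? : Decidable (CycleEdge C)
  cycleEdge? u v = any? λ i →
    ((vertex C i ≟ᶠ u) ×-dec (vertex C (next i) ≟ᶠ v)) ⊎-dec
    ((vertex C i ≟ᶠ v) ×-dec (vertex C (next i) ≟ᶠ u))

  deleteCycleEdges : Graph (Fin n)
  deleteCycleEdges = record
    { Adj    = λ u v → Adj G u v × ¬ CycleEdge C u v
    ; adj?   = λ u v → adj? G u v ×-dec ¬? (cycleEdge? u v)
    ; symm   = λ (uv , ¬c) → symm G uv , λ (i , e) → ¬c (i , swap e)
    ; irrefl = λ u≡v (uv , _) → irrefl G u≡v uv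
    }

  InTreeAt : Fin n → Pred (Fin n) 0ℓ
  InTreeAt v = Star (Adj deleteCycleEdges) v

  -- G{v}, as an unoriented graph.
  treeAt : (v : Fin n) → Graph (Refinement (Fin n) (InTreeAt v))
  treeAt v = induced deleteCycleEdges (InTreeAt v)

  root : (v : Fin n) → Refinement (Fin n) (InTreeAt v)
  root v = v , [ ε ]

  withoutTreeAt : (v : Fin n) → Graph (Refinement (Fin n) (∁ (InTreeAt v)))
  withoutTreeAt v = induced G (∁ (InTreeAt v))

-- The star S_m on m vertices; the centre is vertex number 0.
star : ∀ m → Graph (Fin m)
star m = record
  { Adj    = λ i j → i ≢ j × (toℕ i ≡ 0 ⊎ toℕ j ≡ 0)
  ; adj?   = λ i j → ¬? (i ≟ᶠ j) ×-dec ((toℕ i ℕ.≟ 0) ⊎-dec (toℕ j ℕ.≟ 0))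
  ; symm   = λ (i≢j , z) → ≢-sym i≢j , swap z
  ; irrefl = λ i≡j (i≢j , _) → i≢j i≡j
  }

IsStar : Graph V → Set
IsStar G = ∃[ m ] G ≅ star m

-- For k ≥ 3 the condition i ≢ j is redundant.
cycleGraph : ∀ k → Graph (Fin k)
cycleGraph k = record
  { Adj    = λ i j → i ≢ j × (next i ≡ j ⊎ next j ≡ i)
  ; adj?   = λ i j → ¬? (i ≟ᶠ j) ×-dec ((next i ≟ᶠ j) ⊎-dec (next j ≟ᶠ i))
  ; symm   = λ (i≢j , e) → ≢-sym i≢j , swap e
  ; irrefl = λ i≡j (i≢j , _) → i≢j i≡j
  }

-- C_k and S_m joined by an edge from vertex 0 of C_k to the centre of S_m.
-- This is U* only for m ≥ 1: for m = 0 there is no centre to attach, and what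
-- remains is C_k.
U* : ∀ k m → Graph (Fin k ⊎ Fin m)
U* k m = record { Adj = A ; adj? = A? ; symm = A-sym _ _ ; irrefl = A-irrefl }
  where
  A : Rel (Fin k ⊎ Fin m) 0ℓ
  A (inj₁ i) (inj₁ j) = Adj (cycleGraph k) i j
  A (inj₂ i) (inj₂ j) = Adj (star m) i j
  A (inj₁ i) (inj₂ j) = toℕ i ≡ 0 × toℕ j ≡ 0
  A (inj₂ i) (inj₁ j) = toℕ i ≡ 0 × toℕ j ≡ 0

  A? : Decidable A
  A? (inj₁ i) (inj₁ j) = adj? (cycleGraph k) i j
  A? (inj₂ i) (inj₂ j) = adj? (star m) i j
  A? (inj₁ i) (inj₂ j) = (toℕ i ℕ.≟ 0) ×-dec (toℕ j ℕ.≟ 0)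
  A? (inj₂ i) (inj₁ j) = (toℕ i ℕ.≟ 0) ×-dec (toℕ j ℕ.≟ 0)

  A-sym : ∀ x y → A x y → A y x
  A-sym (inj₁ i) (inj₁ j) = symm (cycleGraph k)
  A-sym (inj₂ i) (inj₂ j) = symm (star m)
  A-sym (inj₁ i) (inj₂ j) (p , q) = q , p
  A-sym (inj₂ i) (inj₁ j) (p , q) = q , p

  A-irrefl : Irreflexive _≡_ A
  A-irrefl {inj₁ i} refl = irrefl (cycleGraph k) refl
  A-irrefl {inj₂ i} refl = irrefl (star m) refl

record Orientation (G : Graph V) : Set₁ where
  field
    Arc      : Rel V 0ℓ
    arc?     : Decidable Arc
    arc⇒adj  : ∀ {u v} → Arc u v → Adj G u v
    adj⇒arc  : ∀ {u v} → Adj G u v → Arc u v ⊎ Arc v u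
    asym     : ∀ {u v} → Arc u v → ¬ Arc v u

open Orientation public

skewAdjacency : {G : Graph V} → Orientation G → V → V → ℚ
skewAdjacency σ u v with arc? σ u v | arc? σ v u
... | yes _ | _     = 1ℚ
... | no  _ | yes _ = - 1ℚ
... | no  _ | no  _ = 0ℚ

-- Only meaningful for even k: for odd k, reversing the direction in which C is
-- traversed changes the sign of the product.
EvenlyOriented : {G : Graph V} → Orientation G → Cycle G k → Set
EvenlyOriented σ C =
  0ℚ < Πℚ (λ i → skewAdjacency σ (vertex C i) (vertex C (next i)))

LinearlyIndependent : (Fin m → Fin n → ℚ) → Set
LinearlyIndependent {m = m} x =
  (c : Fin m → ℚ) → (∀ j → Σℚ (λ i → c i * x i j) ≡ 0ℚ) → ∀ i → c i ≡ 0ℚ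

-- Rank over ℚ, which for a rational matrix is also its rank over ℝ: the
-- largest number of linearly independent rows of A is r. (The rows in an
-- independent family are necessarily pairwise distinct.)
Rank : (Fin m → Fin n → ℚ) → ℕ → Set
Rank {m = m} A r =
    (Σ[ ρ ∈ (Fin r → Fin m) ] LinearlyIndependent (A ∘ ρ))
  × (∀ {s} (ρ : Fin s → Fin m) → LinearlyIndependent (A ∘ ρ) → s ≤ r)

SkewRank : {G : Graph (Fin n)} → Orientation G → ℕ → Set
SkewRank σ = Rank (skewAdjacency σ)

{-# OPTIONS --safe #-}
-- For h = ⌊(k−1)/2⌋ the skew-rank is 2(h+1) in both parities, and only lower bounds on the rank are
-- needed. If M is a matching and some vertex v of the cycle has no M-edge on the cycle, then the
-- subgraph induced on the vertices covered by M has M as its only perfect matching (two of them would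
-- differ by an alternating cycle, but the only cycle is C), so the rows of these vertices are
-- independent and 2|M| ≤ 2(h+1).
--
-- (1) M may be any matching of G{v} together with any matching of G − G{v}. The latter contains a path
-- on k − 1 vertices, hence h disjoint edges, and the former has an edge as v is saturated. So
-- β(G{v}) = 1, which makes this tree a star, and β(G − G{v}) = h.
--
-- (2) M may be h disjoint edges of C − v together with any matching of G − C, so no two edges of G − C
-- are disjoint. If v ∈ C is adjacent to u ∉ C, then u is not a leaf, and no path v u w y leaves C, since
-- either would saturate v in G{v}; this forces U*. If k is even and C is oddly-oriented, the rows of C,
-- of the centre u and of one leaf w are independent, k + 2 in number. For odd k, n > k holds because
-- k + 1 independent rows are distinct.
module Submission where

open import Defs
open import Data.Empty using (⊥; ⊥-elim-irr)
open import Data.Fin using (Fin; zero; suc; toℕ; fromℕ; fromℕ<; inject₁; punchIn; punchOut; opposite;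
  remQuot; combine)
open import Data.Fin.Induction using (<-weakInduction)
open import Data.Fin.Permutation using (↔⇒≡)
import Data.Fin.Properties as Fin
open import Data.Irrelevant using ([_])
open import Data.List using (List; []; _∷_; _++_; length; lookup; map; tabulate)
open import Data.List.Membership.Propositional.Properties using (∈-lookup)
open import Data.List.Properties using (length-++; length-map; length-tabulate)
open import Data.List.Relation.Unary.All as All using (All; []; _∷_)
import Data.List.Relation.Unary.All.Properties as All
open import Data.List.Relation.Unary.AllPairs as AllPairs using (AllPairs; []; _∷_)
import Data.List.Relation.Unary.AllPairs.Properties as AllPairs
open import Data.List.Relation.Unary.Any as Any using ()
open import Data.Nat as ℕ using (ℕ; zero; suc; _∸_; _/_; _%_; _≤_; _<_; z≤n; s≤s; z<s)
open import Data.Nat.DivMod using (m%n<n; m<n⇒m%n≡m; n%n≡0; m*n/n≡m)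
open import Data.Nat.Divisibility using (_∣_; _∤_; divides)
import Data.Nat.Properties as ℕ
open import Data.Product using (Σ-syntax; ∃-syntax; _×_; _,_; proj₁; proj₂; uncurry)
open import Data.Rational as ℚ using (ℚ; 0ℚ; 1ℚ; ½; _+_; _*_; -_)
import Data.Rational.Properties as ℚ
open import Data.Refinement using (Refinement; value; _,_)
open import Data.Sum using (_⊎_; inj₁; inj₂; swap; [_,_]′)
open import Data.Unit using (⊤; tt)
open import Function using (_∘_; id; Injective; Equivalence; _⇔_; mk⇔; mk↔ₛ′)
open import Function.Construct.Composition using (_⇔-∘_; _↔-∘_)
open import Function.Construct.Identity using (⇔-id)
open import Function.Construct.Symmetry using (↔-sym; ⇔-sym)
open import Level using (0ℓ)
open import Relation.Binary using (Rel; DecidableEquality; Symmetric; tri<; tri≈; tri>)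
open import Relation.Binary.Construct.Closure.ReflexiveTransitive as Star using (Star; ε; _◅_; _◅◅_)
open import Relation.Binary.PropositionalEquality
open import Relation.Nullary using (¬_; Dec; yes; no; contradiction)
open import Relation.Nullary.Decidable using (¬?; _×-dec_; _⊎-dec_; decidable-stable; recompute)
open import Relation.Unary using (Pred; Decidable; ∁)

open import Algebra.Properties.CommutativeMonoid.Sum ℚ.+-0-commutativeMonoid
  using (sum-remove; sum-cong-≗; sum-replicate-zero) renaming (sum to Σℚ)
open import Algebra.Properties.CommutativeMonoid.Sum ℚ.*-1-commutativeMonoid
  using () renaming (sum to Πℚ; sum-cong-≗ to Πℚ-cong)
open import Algebra.Properties.Group ℚ.+-0-group using (x∙y⁻¹≈ε⇒x≈y)

private
  variable
    A V W : Set
    h k l m n r s : ℕ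

-- Finite sums with at most two nonzero terms

sum-zero : (f : Fin n → ℚ) → (∀ i → f i ≡ 0ℚ) → Σℚ f ≡ 0ℚ
sum-zero {n} f f≡0 = trans (sum-cong-≗ f≡0) (sum-replicate-zero n)

sum-single : (f : Fin n → ℚ) (i : Fin n) → (∀ j → j ≢ i → f j ≡ 0ℚ) → Σℚ f ≡ f i
sum-single {suc n} f i rest = begin
  Σℚ f                        ≡⟨ sum-remove f ⟩
  f i + Σℚ (f ∘ punchIn i)    ≡⟨ cong (f i +_) (sum-zero _ λ j → rest _ (Fin.punchInᵢ≢i i j)) ⟩
  f i + 0ℚ                    ≡⟨ ℚ.+-identityʳ _ ⟩
  f i                         ∎
  where open ≡-Reasoning

sum-pair : (f : Fin n → ℚ) {i j : Fin n} → i ≢ j →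
           (∀ l → l ≢ i → l ≢ j → f l ≡ 0ℚ) → Σℚ f ≡ f i + f j
sum-pair {suc n} f {i} {j} i≢j rest = begin
  Σℚ f                                  ≡⟨ sum-remove f ⟩
  f i + Σℚ (f ∘ punchIn i)              ≡⟨ cong (f i +_) (sum-single _ (punchOut i≢j) λ l l≢ →
                                             rest _ (Fin.punchInᵢ≢i i l) λ e → l≢
                                               (Fin.punchIn-injective i l _
                                                 (trans e (sym (Fin.punchIn-punchOut i≢j))))) ⟩
  f i + f (punchIn i (punchOut i≢j))    ≡⟨ cong (λ x → f i + f x) (Fin.punchIn-punchOut i≢j) ⟩
  f i + f j                             ∎
  where open ≡-Reasoning

-- The cyclic successor, and first repetitions in a sequence

toℕ-next : (i : Fin (suc m)) → toℕ i < m → toℕ (next i) ≡ suc (toℕ i)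
toℕ-next {m} i i<m = trans (Fin.toℕ-fromℕ< (m%n<n (suc (toℕ i)) (suc m))) (m<n⇒m%n≡m (s≤s i<m))

toℕ-next-last : (i : Fin (suc m)) → toℕ i ≡ m → toℕ (next i) ≡ 0
toℕ-next-last {m} i i≡m =
  trans (Fin.toℕ-fromℕ< (m%n<n (suc (toℕ i)) (suc m)))
    (trans (cong (λ x → suc x % suc m) i≡m) (n%n≡0 (suc m)))

next-cases : (i : Fin (suc m)) → (toℕ i < m × toℕ (next i) ≡ suc (toℕ i)) ⊎ (toℕ i ≡ m × toℕ (next i) ≡ 0)
next-cases i with ℕ.m<1+n⇒m<n∨m≡n (Fin.toℕ<n i)
... | inj₁ i<m = inj₁ (i<m , toℕ-next i i<m)
... | inj₂ i≡m = inj₂ (i≡m , toℕ-next-last i i≡m)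

-- Replaces the wrap-around of `next` by the closing condition `y k ≡ y 0`, so that a closed walk
-- indexed by ℕ can be read as a cycle.
at-next : (y : ℕ → V) → y k ≡ y 0 → (i : Fin k) → y (toℕ (next i)) ≡ y (suc (toℕ i))
at-next {k = suc m} y closed i with next-cases i
... | inj₁ (_ , e)   = cong y e
... | inj₂ (i≡m , e) = trans (cong y e) (trans (sym closed) (cong (y ∘ suc) (sym i≡m)))

next-injective : Injective _≡_ _≡_ (next {k})
next-injective {suc m} {i} {j} e with next-cases i | next-cases j
... | inj₁ (_ , p) | inj₁ (_ , q) = Fin.toℕ-injective (ℕ.suc-injective (trans (sym p) (trans (cong toℕ e) q)))
... | inj₁ (_ , p) | inj₂ (_ , q) = contradiction (trans (sym p) (trans (cong toℕ e) q)) λ ()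
... | inj₂ (_ , p) | inj₁ (_ , q) = contradiction (trans (sym q) (trans (cong toℕ (sym e)) p)) λ ()
... | inj₂ (p , _) | inj₂ (q , _) = Fin.toℕ-injective (trans p (sym q))

next-inject₁ : (i : Fin m) → next (inject₁ i) ≡ suc i
next-inject₁ {m} i = Fin.toℕ-injective (trans
  (toℕ-next (inject₁ i) (subst (_< m) (sym (Fin.toℕ-inject₁ i)) (Fin.toℕ<n i)))
  (cong suc (Fin.toℕ-inject₁ i)))

next-fromℕ : ∀ m → next (fromℕ m) ≡ zero
next-fromℕ m = Fin.toℕ-injective (toℕ-next-last (fromℕ m) (Fin.toℕ-fromℕ m))

next-surjective : (i : Fin k) → ∃[ j ] next j ≡ i
next-surjective {suc m} zero    = fromℕ m , next-fromℕ m
next-surjective {suc m} (suc i) = inject₁ i , next-inject₁ i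

-- The two neighbours of `next i` on a cycle are `i` and `next (next i)`. That they differ lets
-- `sum-pair` evaluate the column of `next i`.
next²≢ : 3 ≤ k → (i : Fin k) → next (next i) ≢ i
next²≢ {suc m} (s≤s 2≤m) i e with next-cases i | next-cases (next i)
... | inj₁ (_ , p) | inj₁ (_ , q) = contradiction (trans (sym (cong toℕ e)) (trans q (cong suc p))) (ℕ.m≢1+n+m _ {1})
... | inj₁ (_ , p) | inj₂ (r , q) =
  contradiction (subst (2 ≤_) (trans (trans (sym r) p) (cong suc (trans (cong toℕ (sym e)) q))) 2≤m) λ { (s≤s ()) }
... | inj₂ (r , p) | inj₁ (_ , q) =
  contradiction (subst (2 ≤_) (trans (sym r) (trans (cong toℕ (sym e)) (trans q (cong suc p)))) 2≤m) λ { (s≤s ()) }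
... | inj₂ (r , p) | inj₂ (r′ , _) = contradiction (subst (2 ≤_) (trans (sym r′) p) 2≤m) λ ()

<-distinct⇒injective : ∀ {l} (y : ℕ → V) → (∀ p q → p < q → q < l → y p ≢ y q) →
                       ∀ {p q} → p < l → q < l → y p ≡ y q → p ≡ q
<-distinct⇒injective y dist {p} {q} p<l q<l e with ℕ.<-cmp p q
... | tri< p<q _ _ = contradiction e (dist p q p<q q<l)
... | tri≈ _ p≡q _ = p≡q
... | tri> _ _ q<p = contradiction (sym e) (dist q p q<p p<l)

-- A repetition-free prefix is extended one term at a time, which the pigeonhole principle stops.
-- Stopping at the first repetition keeps all earlier terms distinct, so the stretch from `i` to `j`
-- closes up without crossing itself.
firstRepetition : (z : ℕ → Fin n) →
  ∃[ i ] ∃[ j ] (i < j × z i ≡ z j × (∀ p q → p < q → q < j → z p ≢ z q))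
firstRepetition {n} z with search (suc n)
  where
  Repetition = ∃[ i ] ∃[ j ] (i < j × z i ≡ z j × (∀ p q → p < q → q < j → z p ≢ z q))
  search : ∀ N → Repetition ⊎ (∀ p q → p < q → q < N → z p ≢ z q)
  search zero = inj₂ λ _ _ _ ()
  search (suc N) with search N
  ... | inj₁ rep = inj₁ rep
  ... | inj₂ dist with ℕ.anyUpTo? (λ i → z i Fin.≟ z N) N
  ...   | yes (i , i<N , e) = inj₁ (i , N , i<N , e , dist)
  ...   | no ¬rep = inj₂ λ p q p<q q<1+N →
            [ dist p q p<q , (λ { refl e → ¬rep (p , p<q , e) }) ]′ (ℕ.m<1+n⇒m<n∨m≡n q<1+N)
... | inj₁ rep = rep
... | inj₂ dist =
  let i , j , i<j , e = Fin.pigeonhole (ℕ.n<1+n n) (z ∘ toℕ)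
  in contradiction e (dist _ _ i<j (Fin.toℕ<n j))

-- Cycles and bridges

module _ {G : Graph V} where

  closedWalk⇒cycle : 3 ≤ l → (y : ℕ → V) → y l ≡ y 0 →
                     (∀ t → t < l → Adj G (y t) (y (suc t))) →
                     (∀ p q → p < q → q < l → y p ≢ y q) → Cycle G l
  closedWalk⇒cycle 3≤l y closed adj dist = record
    { 3≤k       = 3≤l
    ; vertex    = y ∘ toℕ
    ; injective = λ {i} {j} e → Fin.toℕ-injective
                    (<-distinct⇒injective y dist (Fin.toℕ<n i) (Fin.toℕ<n j) e)
    ; adjacent  = λ i → subst (Adj G (y (toℕ i))) (sym (at-next y closed i)) (adj _ (Fin.toℕ<n i))
    }

  closedWalk-edge : ∀ 3≤l y closed adj dist {t} → t < l →
                    CycleEdge (closedWalk⇒cycle {l} 3≤l y closed adj dist) (y t) (y (suc t))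
  closedWalk-edge 3≤l y closed adj dist {t} t<l = fromℕ< t<l ,
    inj₁ (cong y e , trans (at-next y closed (fromℕ< t<l)) (cong (y ∘ suc) e))
    where e = Fin.toℕ-fromℕ< t<l

  cycleEdge-sym : (C : Cycle G k) → ∀ {u v} → CycleEdge C u v → CycleEdge C v u
  cycleEdge-sym C (i , e) = i , swap e

  cycleEdge⇒adj : (C : Cycle G k) → ∀ {u v} → CycleEdge C u v → Adj G u v
  cycleEdge⇒adj C (i , inj₁ (refl , refl)) = adjacent C i
  cycleEdge⇒adj C (i , inj₂ (refl , refl)) = symm G (adjacent C i)

  cycleEdge⇒onCycle : (C : Cycle G k) → ∀ {u v} → CycleEdge C u v → OnCycle C u
  cycleEdge⇒onCycle C (i , inj₁ (e , _)) = i , e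
  cycleEdge⇒onCycle C (i , inj₂ (_ , e)) = next i , e

  alongCycle : (C : Cycle G k) → ∀ {u v} → OnCycle C u → OnCycle C v → Star (CycleEdge C) u v
  alongCycle {suc m} C (i , refl) (j , refl) =
    Star.reverse (cycleEdge-sym C) (from0 i) ◅◅ from0 j
    where
    from0 : ∀ i → Star (CycleEdge C) (vertex C zero) (vertex C i)
    from0 = <-weakInduction _ ε λ i w →
      w ◅◅ ((inject₁ i , inj₁ (refl , cong (vertex C) (next-inject₁ i))) ◅ ε)
  alongCycle {zero} C (() , _)

-- `point` is total on ℕ; its values beyond `len` carry no information.
record SimplePath (R : Rel V 0ℓ) (u v : V) : Set where
  field
    len      : ℕ
    point    : ℕ → V
    start    : point 0 ≡ u
    end      : point len ≡ v
    step     : ∀ t → t < len → R (point t) (point (suc t))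
    distinct : ∀ p q → p < q → q ≤ len → point p ≢ point q

module _ {R : Rel V 0ℓ} where

  open SimplePath

  segment : ∀ (y : ℕ → V) i d → (∀ t → t < d → R (y (i ℕ.+ t)) (y (suc (i ℕ.+ t)))) →
            Star R (y i) (y (i ℕ.+ d))
  segment y i zero    step = subst (λ t → Star R (y i) (y t)) (sym (ℕ.+-identityʳ i)) ε
  segment y i (suc d) step = subst (λ t → Star R (y i) (y t)) (sym (ℕ.+-suc i d))
    (segment y i d (λ t t<d → step t (ℕ.m<n⇒m<1+n t<d)) ◅◅ (step d (ℕ.n<1+n d) ◅ ε))

  -- Loop erasure: if the path built so far already visits the new first vertex, it is cut to start
  -- at that visit.
  simplePath : DecidableEquality V → ∀ {u v} → Star R u v → SimplePath R u v
  simplePath _≟_ {u} ε = record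
    { len = 0 ; point = λ _ → u ; start = refl ; end = refl ; step = λ _ ()
    ; distinct = λ { _ _ () z≤n } }
  simplePath _≟_ {u} {v} (uw ◅ walk) with simplePath _≟_ walk
  ... | p with ℕ.anyUpTo? (λ i → point p i ≟ u) (suc (len p))
  ...   | yes (i , s≤s i≤len , e) = record
    { len      = len p ∸ i
    ; point    = λ t → point p (i ℕ.+ t)
    ; start    = trans (cong (point p) (ℕ.+-identityʳ i)) e
    ; end      = trans (cong (point p) (ℕ.m+[n∸m]≡n i≤len)) (end p)
    ; step     = λ t t< → subst (R _) (cong (point p) (sym (ℕ.+-suc i t)))
                   (step p _ (subst (i ℕ.+ t <_) (ℕ.m+[n∸m]≡n i≤len) (ℕ.+-monoʳ-< i t<)))
    ; distinct = λ s t s<t t≤ → distinct p _ _ (ℕ.+-monoʳ-< i s<t)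
                   (subst (i ℕ.+ t ≤_) (ℕ.m+[n∸m]≡n i≤len) (ℕ.+-monoʳ-≤ i t≤)) }
  ...   | no ¬visited = record
    { len      = suc (len p)
    ; point    = λ { zero → u ; (suc t) → point p t }
    ; start    = refl
    ; end      = end p
    ; step     = λ { zero _ → subst (R u) (sym (start p)) uw ; (suc t) (s≤s t<) → step p t t< }
    ; distinct = λ { zero    (suc t) _         (s≤s t≤) e → ¬visited (t , s≤s t≤ , sym e)
                   ; (suc s) (suc t) (s≤s s<t) (s≤s t≤) e → distinct p s t s<t t≤ e } }

module Unicyclic {G : Graph (Fin n)} {k} (C : Cycle G k) (unique : IsUniqueCycle C) where

  open SimplePath

  Avoiding : Fin n → Fin n → Rel (Fin n) 0ℓ
  Avoiding a b u v = Adj G u v × ¬ (u ≡ a × v ≡ b) × ¬ (u ≡ b × v ≡ a)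

  onCycle? : ∀ v → Dec (OnCycle C v)
  onCycle? v = Fin.any? λ i → vertex C i Fin.≟ v

  -- All cycles have the edges of `C`, so an edge off `C` lies on no cycle. A simple path from `b`
  -- to `a` that avoids this edge has at least two steps: with none `a` and `b` would coincide, and
  -- with one it would be the edge itself. The edge would then close it to a cycle.
  bridge : ∀ {a b} → Adj G a b → ¬ CycleEdge C a b → ¬ Star (Avoiding a b) b a
  bridge {a} {b} ab ¬c walk with simplePath Fin._≟_ walk
  ... | record { len = 0 ; start = s ; end = e } = irrefl G (trans (sym e) s) ab
  ... | record { len = 1 ; start = refl ; end = refl ; step = st } =
          let _ , _ , ¬ba = st 0 z<s in ¬ba (refl , refl)
  ... | record { len = suc (suc len) ; point = x ; start = refl ; end = refl ; step = st ; distinct = dist } =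
          ¬c (Equivalence.to (unique D a b) (closedWalk-edge {G = G} 3≤l y refl adj dist′ z<s))
    where
    y : ℕ → Fin n
    y zero    = a
    y (suc t) = x t

    3≤l = s≤s (s≤s (s≤s z≤n))

    adj : ∀ t → t < suc (suc (suc len)) → Adj G (y t) (y (suc t))
    adj zero    _         = ab
    adj (suc t) (s≤s t<) = proj₁ (st t t<)

    dist′ : ∀ p q → p < q → q < suc (suc (suc len)) → y p ≢ y q
    dist′ zero    (suc q) _         (s≤s q<) e = dist q (suc (suc len)) q< ℕ.≤-refl (sym e)
    dist′ (suc p) (suc q) (s≤s p<q) (s≤s q<) e = dist p q p<q (ℕ.<⇒≤ q<) e

    D = closedWalk⇒cycle {G = G} 3≤l y refl adj dist′

  alongCycleAvoiding : ∀ {a b u v} → ¬ CycleEdge C a b → OnCycle C u → OnCycle C v → Star (Avoiding a b) u v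
  alongCycleAvoiding ¬c u∈C v∈C = Star.map
    (λ e → cycleEdge⇒adj C e , (λ { (refl , refl) → ¬c e }) , λ { (refl , refl) → ¬c (cycleEdge-sym C e) })
    (alongCycle C u∈C v∈C)

  -- The ends of a chord are also joined along `C`, so a chord would not be a bridge.
  chordless : ∀ {u v} → OnCycle C u → OnCycle C v → Adj G u v → CycleEdge C u v
  chordless {u} {v} u∈C v∈C uv with cycleEdge? C u v
  ... | yes c = c
  ... | no ¬c = contradiction (alongCycleAvoiding ¬c v∈C u∈C) (bridge uv ¬c)

  -- On a simple path of positive length from `u` to `v` the first edge is off `C`. The rest of the
  -- path never returns to `u`, and continuing from `v` to `u` along `C` gives a detour around that
  -- first edge.
  tree∩cycle : ∀ {u v} → OnCycle C u → OnCycle C v → InTreeAt C u v → u ≡ v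
  tree∩cycle u∈C v∈C walk with simplePath Fin._≟_ walk
  ... | record { len = 0 ; start = s ; end = e } = trans (sym s) e
  ... | record { len = suc len ; point = x ; start = refl ; end = refl ; step = st ; distinct = dist } =
          let uy , ¬c = st 0 z<s in contradiction
            (segment x 1 len (λ t t<len → proj₁ (st _ (s≤s t<len))
                , (λ (e , _) → dist 0 (suc t) z<s (ℕ.m≤n⇒m≤1+n t<len) (sym e))
                , (λ (_ , e) → dist 0 (suc (suc t)) z<s (s≤s t<len) (sym e)))
              ◅◅ alongCycleAvoiding ¬c v∈C u∈C)
            (bridge uy ¬c)

-- Independence of the rows of a matching

module Skew {G : Graph V} (σ : Orientation G) where

  S = skewAdjacency σ

  S-adj : ∀ {u v} → Adj G u v → S u v ≡ 1ℚ ⊎ S u v ≡ - 1ℚ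
  S-adj {u} {v} uv with arc? σ u v | arc? σ v u
  ... | yes _  | _      = inj₁ refl
  ... | no _   | yes _  = inj₂ refl
  ... | no ¬uv | no ¬vu = contradiction (adj⇒arc σ uv) [ ¬uv , ¬vu ]′

  S-nonadj : ∀ {u v} → ¬ Adj G u v → S u v ≡ 0ℚ
  S-nonadj {u} {v} ¬uv with arc? σ u v | arc? σ v u
  ... | yes uv | _      = contradiction (arc⇒adj σ uv) ¬uv
  ... | no _   | yes vu = contradiction (symm G (arc⇒adj σ vu)) ¬uv
  ... | no _   | no _   = refl

  S-antisym : ∀ u v → S u v ≡ - S v u
  S-antisym u v with arc? σ u v | arc? σ v u
  ... | yes uv | yes vu = contradiction vu (asym σ uv)
  ... | yes _  | no _   = refl
  ... | no _   | yes _  = refl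
  ... | no _   | no _   = refl

  S²≡1 : ∀ {u v} → Adj G u v → S u v * S u v ≡ 1ℚ
  S²≡1 uv with S-adj uv
  ... | inj₁ e rewrite e = refl
  ... | inj₂ e rewrite e = refl

  S≢0⇒adj : ∀ {u v} → S u v ≢ 0ℚ → Adj G u v
  S≢0⇒adj {u} {v} S≢0 = decidable-stable (adj? G u v) (S≢0 ∘ S-nonadj)

  *S≡0⇒≡0 : ∀ x {u v} → Adj G u v → x * S u v ≡ 0ℚ → x ≡ 0ℚ
  *S≡0⇒≡0 x {u} {v} uv e = begin
    x                     ≡⟨ ℚ.*-identityʳ x ⟨
    x * 1ℚ                ≡⟨ cong (x *_) (S²≡1 uv) ⟨
    x * (S u v * S u v)   ≡⟨ ℚ.*-assoc x _ _ ⟨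
    x * S u v * S u v     ≡⟨ cong (_* S u v) e ⟩
    0ℚ * S u v            ≡⟨ ℚ.*-zeroˡ (S u v) ⟩
    0ℚ                    ∎
    where open ≡-Reasoning

-- A nonzero coefficient c i forces, in the column of the mate of i, another nonzero coefficient at
-- a neighbour of that mate. Iterating gives an infinite walk that alternates between mates and
-- other neighbours and never backtracks, so it closes a cycle, which must be C. Every vertex of
-- that cycle but possibly the one where it closes up has its mate edge on the cycle. So the walk
-- closes up at v, which it meets after leaving its start, and c is nonzero there. Hence the walk
-- started at v itself would meet v twice before it closes up.
module AlternatingWalk
  {G : Graph (Fin n)} (σ : Orientation G) {k} (C : Cycle G k) (unique : IsUniqueCycle C)
  (ρ : Fin s → Fin n) (ρ-injective : Injective _≡_ _≡_ ρ)
  (mate : Fin s → Fin s) (mate-involutive : ∀ i → mate (mate i) ≡ i)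
  (mate-adj : ∀ i → Adj G (ρ i) (ρ (mate i)))
  {v} (v∈C : OnCycle C v)
  (avoids : ∀ i → ρ i ≡ v → ¬ CycleEdge C (ρ i) (ρ (mate i)))
  where

  open Skew σ

  independent : LinearlyIndependent (S ∘ ρ)
  independent c columns = λ i → decidable-stable (c i ℚ.≟ 0ℚ) λ ci≢0 →
    let a , ρa≡v , ca≢0 , _    = returns i ci≢0
        b , ρb≡v , _    , b≢a  = returns a ca≢0
    in b≢a (ρ-injective (trans ρb≡v (sym ρa≡v)))
    where
    propagate : ∀ i → c i ≢ 0ℚ → ∃[ a ] (a ≢ i × c a ≢ 0ℚ × Adj G (ρ a) (ρ (mate i)))
    propagate i ci≢0
      with Fin.any? (λ a → ¬? (a Fin.≟ i) ×-dec ¬? (c a * S (ρ a) (ρ (mate i)) ℚ.≟ 0ℚ))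
    ... | yes (a , a≢i , f≢0) = a , a≢i
          , (λ e → f≢0 (trans (cong (_* S (ρ a) (ρ (mate i))) e) (ℚ.*-zeroˡ (S (ρ a) (ρ (mate i))))))
          , S≢0⇒adj λ e → f≢0 (trans (cong (c a *_) e) (ℚ.*-zeroʳ (c a)))
    ... | no ¬other = contradiction
          (*S≡0⇒≡0 (c i) (mate-adj i) (trans (sym (sum-single _ i λ a a≢i →
            decidable-stable (_ ℚ.≟ 0ℚ) λ f≢0 → ¬other (a , a≢i , f≢0))) (columns (ρ (mate i)))))
          ci≢0

    -- An even state is about to cross the mate edge of its index and carries a nonzero coefficient
    -- there. An odd state has just crossed it, so the nonzero coefficient sits at the mate of its
    -- index.
    data State : Set where
      even : ∀ i → c i ≢ 0ℚ → State
      odd  : ∀ i → c (mate i) ≢ 0ℚ → State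

    Even : State → Set
    Even (even _ _) = ⊤
    Even (odd _ _)  = ⊥

    even? : ∀ x → Dec (Even x)
    even? (even _ _) = yes tt
    even? (odd _ _)  = no λ ()

    index : State → Fin s
    index (even i _) = i
    index (odd i _)  = i

    advance : State → State
    advance (even i p) = odd (mate i) (subst (λ j → c j ≢ 0ℚ) (sym (mate-involutive i)) p)
    advance (odd i p)  = let a , _ , ca≢0 , _ = propagate (mate i) p in even a ca≢0

    advance-adj : ∀ x → Adj G (ρ (index x)) (ρ (index (advance x)))
    advance-adj (even i _) = mate-adj i
    advance-adj (odd i p)  = let a , _ , _ , adj = propagate (mate i) p in
      symm G (subst (Adj G (ρ a) ∘ ρ) (mate-involutive i) adj)

    nonbacktracking : ∀ x → index (advance (advance x)) ≢ index x
    nonbacktracking (even i p) e = let _ , a≢i , _ = propagate (mate (mate i)) _ in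
      a≢i (trans e (sym (mate-involutive i)))
    nonbacktracking (odd i p)  e = let a , a≢i , _ = propagate (mate i) p in
      a≢i (trans (sym (mate-involutive a)) (cong mate e))

    even⇒mate : ∀ x → Even x → index (advance x) ≡ mate (index x)
    even⇒mate (even i _) _ = refl

    ¬even⇒even : ∀ x → ¬ Even (advance x) → Even x
    ¬even⇒even (even _ _) _ = tt
    ¬even⇒even (odd _ _)  ¬e = contradiction tt ¬e

    even⇒nonzero : ∀ x → Even x → c (index x) ≢ 0ℚ
    even⇒nonzero (even _ p) _ = p

    walk : ∀ i → c i ≢ 0ℚ → ℕ → State
    walk i ci≢0 zero    = even i ci≢0
    walk i ci≢0 (suc t) = advance (walk i ci≢0 t)

    returns : ∀ i → c i ≢ 0ℚ → ∃[ a ] (ρ a ≡ v × c a ≢ 0ℚ × a ≢ i)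
    returns i ci≢0 with firstRepetition (index ∘ walk i ci≢0)
    ... | a , b , a<b , repeated , dist with ℕ.m≤n⇒∃[o]m+o≡n a<b
    -- The repetition is at `a` and `b = 1 + a + o`, so the closed walk `D` has length `1 + o`. By
    -- uniqueness it has the edges of `C`, hence one at `v`.
    ... | o , refl = locate (Equivalence.from (unique D _ _) (proj₁ v∈C , inj₁ (proj₂ v∈C , refl)))
      where
      state = walk i ci≢0

      z : ℕ → Fin s
      z = index ∘ state

      y : ℕ → Fin n
      y t = ρ (z (a ℕ.+ t))

      closed : z (a ℕ.+ suc o) ≡ z a
      closed = trans (cong z (ℕ.+-suc a o)) (sym repeated)

      y-closed : y (suc o) ≡ y 0
      y-closed = cong ρ (trans closed (cong z (sym (ℕ.+-identityʳ a))))

      long : ∀ o → z (a ℕ.+ suc o) ≡ z a → 3 ≤ suc o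
      long 0 e = contradiction (advance-adj (state a))
        (irrefl G (cong ρ (trans (sym e) (cong z (ℕ.+-comm a 1)))))
      long 1 e = contradiction (trans (cong z (ℕ.+-comm 2 a)) e) (nonbacktracking (state a))
      long (suc (suc o)) _ = s≤s (s≤s (s≤s z≤n))

      3≤l = long o closed

      adj : ∀ t → t < suc o → Adj G (y t) (y (suc t))
      adj t _ = subst (Adj G (y t) ∘ ρ ∘ z) (sym (ℕ.+-suc a t)) (advance-adj (state (a ℕ.+ t)))

      dist′ : ∀ p q → p < q → q < suc o → y p ≢ y q
      dist′ p q p<q q<l e = dist _ _ (ℕ.+-monoʳ-< a p<q)
        (subst (a ℕ.+ q <_) (ℕ.+-suc a o) (ℕ.+-monoʳ-< a q<l)) (ρ-injective e)

      D = closedWalk⇒cycle {G = G} 3≤l y y-closed adj dist′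

      mateEdge : ∀ {t} → t < suc o → Even (state (a ℕ.+ t)) → CycleEdge C (y t) (ρ (mate (z (a ℕ.+ t))))
      mateEdge {t} t<l ev = subst (CycleEdge C (y t) ∘ ρ)
        (trans (cong z (ℕ.+-suc a t)) (even⇒mate _ ev))
        (Equivalence.to (unique D _ _) (closedWalk-edge {G = G} 3≤l y y-closed adj dist′ t<l))

      -- The walk leaves an even state, and has entered an odd one, by the mate edge. When that edge
      -- belongs to `D` it lies on `C`, so by `avoids` the vertex cannot be `v`.
      leaves : ∀ {t} → t < suc o → Even (state (a ℕ.+ t)) → y t ≢ v
      leaves t<l ev e = avoids _ e (mateEdge t<l ev)

      enters : ∀ {t} → t < suc o → ¬ Even (state (a ℕ.+ suc t)) → y (suc t) ≢ v
      enters {t} t<l ¬ev e rewrite ℕ.+-suc a t = avoids (mate (z (a ℕ.+ t)))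
        (trans (cong ρ (sym (even⇒mate _ ev))) e)
        (subst (CycleEdge C (ρ (mate (z (a ℕ.+ t)))) ∘ ρ) (sym (mate-involutive _))
          (cycleEdge-sym C (mateEdge t<l ev)))
        where ev = ¬even⇒even _ ¬ev

      locate : ∀ {w} → CycleEdge D v w → _
      locate v∈D with cycleEdge⇒onCycle D v∈D
      ... | d , yd≡v with toℕ d | Fin.toℕ<n d
      ...   | t | t<l with even? (state (a ℕ.+ t))
      ...     | yes ev = contradiction yd≡v (leaves t<l ev)
      locate v∈D | d , yd≡v | suc t | t<l | no ¬ev =
        contradiction yd≡v (enters (ℕ.<-trans (ℕ.n<1+n t) t<l) ¬ev)
      -- The remaining position of `v` is the closing point, left in an odd state at time `a`. The
      -- return at time `1 + a + o` must be in an even state, which supplies the nonzero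
      -- coefficient. As the state at time 0 is even, `a` is not 0, and the index there differs from
      -- the starting index `i` because it precedes the first repetition.
      locate v∈D | d , yd≡v | zero  | t<l | no ¬ev with even? (state (a ℕ.+ suc o))
      ... | no ¬ev′ = contradiction (trans y-closed yd≡v) (enters (ℕ.n<1+n o) ¬ev′)
      ... | yes ev′ = z (a ℕ.+ suc o) , trans y-closed yd≡v , even⇒nonzero _ ev′ , λ e →
              dist 0 a (ℕ.n≢0⇒n>0 a≢0) (s≤s (ℕ.m≤m+n a o)) (trans (sym e) closed)
        where
        a≢0 : a ≢ 0
        a≢0 refl = ¬ev tt

Disjoint : Rel (A × A) 0ℓ
Disjoint (a , b) (c , d) = a ≢ c × a ≢ d × b ≢ c × b ≢ d

disjoint-sym : Symmetric (Disjoint {A})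
disjoint-sym (p , q , r , s) = ≢-sym p , ≢-sym r , ≢-sym q , ≢-sym s

allPairs-lookup : {R : Rel A 0ℓ} → Symmetric R → ∀ {xs} → AllPairs R xs →
                  ∀ {i j} → i ≢ j → R (lookup xs i) (lookup xs j)
allPairs-lookup R-sym (x ∷ xs) {zero}  {zero}  i≢j = contradiction refl i≢j
allPairs-lookup R-sym (x ∷ xs) {zero}  {suc j} i≢j = All.lookup x (∈-lookup j)
allPairs-lookup R-sym (x ∷ xs) {suc i} {zero}  i≢j = R-sym (All.lookup x (∈-lookup i))
allPairs-lookup R-sym (x ∷ xs) {suc i} {suc j} i≢j = allPairs-lookup R-sym xs (i≢j ∘ cong suc)

module _ {G : Graph (Fin n)} (σ : Orientation G) {k} (C : Cycle G k) (unique : IsUniqueCycle C) where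

  -- The rows are those of the covered vertices, two per edge, and `mate` is the other end of the
  -- same edge. `remQuot` and `combine` convert between a row index and a pair of an edge and one of
  -- its two ends.
  matching-bound : ∀ {r v} → SkewRank σ r → OnCycle C v → (M : Matching G) →
    All (λ (a , b) → CycleEdge C a b → v ≢ a × v ≢ b) (edges M) → size M ℕ.* 2 ≤ r
  matching-bound {v = v} (_ , maximal) v∈C M avoid = maximal ρ (AlternatingWalk.independent
    σ C unique ρ ρ-injective mate mate-involutive mate-adj v∈C avoids)
    where
    es = edges M

    endpoint : Fin (length es) × Fin 2 → Fin n
    endpoint (q , zero)     = proj₁ (lookup es q)
    endpoint (q , suc zero) = proj₂ (lookup es q)

    flip : Fin (length es) × Fin 2 → Fin (length es) × Fin 2
    flip (q , e) = q , opposite e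

    flip-involutive : ∀ x → flip (flip x) ≡ x
    flip-involutive (q , e) = cong (q ,_) (Fin.opposite-involutive e)

    ends : Fin (length es ℕ.* 2) → Fin (length es) × Fin 2
    ends = remQuot 2

    ρ : Fin (length es ℕ.* 2) → Fin n
    ρ = endpoint ∘ ends

    mate : Fin (length es ℕ.* 2) → Fin (length es ℕ.* 2)
    mate = uncurry combine ∘ flip ∘ ends

    ends-mate : ∀ i → ends (mate i) ≡ flip (ends i)
    ends-mate i = uncurry Fin.remQuot-combine (flip (ends i))

    ends-injective : ∀ {i j} → ends i ≡ ends j → i ≡ j
    ends-injective {i} {j} e = trans (sym (Fin.combine-remQuot {length es} 2 i))
      (trans (cong (uncurry combine) e) (Fin.combine-remQuot {length es} 2 j))

    mate-involutive : ∀ i → mate (mate i) ≡ i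
    mate-involutive i = ends-injective (trans (ends-mate (mate i))
      (trans (cong flip (ends-mate i)) (flip-involutive (ends i))))

    edge : ∀ q → Adj G (proj₁ (lookup es q)) (proj₂ (lookup es q))
    edge q = All.lookup (areEdges M) (∈-lookup q)

    endpoint-adj : ∀ x → Adj G (endpoint x) (endpoint (flip x))
    endpoint-adj (q , zero)     = edge q
    endpoint-adj (q , suc zero) = symm G (edge q)

    mate-adj : ∀ i → Adj G (ρ i) (ρ (mate i))
    mate-adj i = subst (Adj G (ρ i) ∘ endpoint) (sym (ends-mate i)) (endpoint-adj (ends i))

    endpoint-avoids : ∀ x → endpoint x ≡ v → ¬ CycleEdge C (endpoint x) (endpoint (flip x))
    endpoint-avoids (q , zero)     e c = proj₁ (All.lookup avoid (∈-lookup q) c) (sym e)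
    endpoint-avoids (q , suc zero) e c =
      proj₂ (All.lookup avoid (∈-lookup q) (cycleEdge-sym C c)) (sym e)

    avoids : ∀ i → ρ i ≡ v → ¬ CycleEdge C (ρ i) (ρ (mate i))
    avoids i e c = endpoint-avoids (ends i) e (subst (CycleEdge C (ρ i) ∘ endpoint) (ends-mate i) c)

    apart : ∀ {p q} → p ≢ q → Disjoint (lookup es p) (lookup es q)
    apart = allPairs-lookup disjoint-sym (disjoint M)

    endpoint-injective : ∀ x y → endpoint x ≡ endpoint y → x ≡ y
    endpoint-injective (p , d) (q , e) eq with p Fin.≟ q
    endpoint-injective (p , zero)     (p , zero)     eq | yes refl = refl
    endpoint-injective (p , zero)     (p , suc zero) eq | yes refl = contradiction (edge p) (irrefl G eq)
    endpoint-injective (p , suc zero) (p , zero)     eq | yes refl = contradiction (edge p) (irrefl G (sym eq))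
    endpoint-injective (p , suc zero) (p , suc zero) eq | yes refl = refl
    endpoint-injective (p , zero)     (q , zero)     eq | no p≢q =
      contradiction eq (proj₁ (apart p≢q))
    endpoint-injective (p , zero)     (q , suc zero) eq | no p≢q =
      contradiction eq (proj₁ (proj₂ (apart p≢q)))
    endpoint-injective (p , suc zero) (q , zero)     eq | no p≢q =
      contradiction eq (proj₁ (proj₂ (proj₂ (apart p≢q))))
    endpoint-injective (p , suc zero) (q , suc zero) eq | no p≢q =
      contradiction eq (proj₂ (proj₂ (proj₂ (apart p≢q))))

    ρ-injective : Injective _≡_ _≡_ ρ
    ρ-injective e = ends-injective (endpoint-injective _ _ e)

-- Matchings, paths along the cycle, and stars

module _ {G : Graph V} where

  ∅ : Matching G
  ∅ = record { edges = [] ; areEdges = [] ; disjoint = [] }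

  insertEdge : ∀ {u v} → Adj G u v → (M : Matching G) → All (Disjoint (u , v)) (edges M) → Matching G
  insertEdge {u} {v} uv M d = record
    { edges = (u , v) ∷ edges M ; areEdges = uv ∷ areEdges M ; disjoint = d ∷ disjoint M }

  _∪_[_] : (M N : Matching G) → All (λ e → All (Disjoint e) (edges N)) (edges M) → Matching G
  M ∪ N [ d ] = record
    { edges    = edges M ++ edges N
    ; areEdges = All.++⁺ (areEdges M) (areEdges N)
    ; disjoint = AllPairs.++⁺ (disjoint M) (disjoint N) d
    }

  tabulateMatching : (a b : Fin s → V) → (∀ t → Adj G (a t) (b t)) →
                     (∀ {t t′} → t ≢ t′ → Disjoint (a t , b t) (a t′ , b t′)) → Matching G
  tabulateMatching a b ab d = record
    { edges    = tabulate λ t → a t , b t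
    ; areEdges = All.tabulate⁺ ab
    ; disjoint = AllPairs.tabulate⁺ d
    }

  mapMatching : {H : Graph W} (f : V → W) → Injective _≡_ _≡_ f →
                (∀ {u v} → Adj G u v → Adj H (f u) (f v)) → Matching G → Matching H
  mapMatching f f-inj hom M = record
    { edges    = map (λ (a , b) → f a , f b) (edges M)
    ; areEdges = All.map⁺ (All.map hom (areEdges M))
    ; disjoint = AllPairs.map⁺ (AllPairs.map
        (λ (p , q , r , s) → p ∘ f-inj , q ∘ f-inj , r ∘ f-inj , s ∘ f-inj) (disjoint M))
    }

value-injective : ∀ {P : Pred V 0ℓ} → Injective _≡_ _≡_ (value {P = P})
value-injective {x = _ , [ _ ]} {_ , [ _ ]} refl = refl

¬disjoint⇒meet : ∀ {a b c d : Fin n} → ¬ Disjoint (a , b) (c , d) → (a ≡ c ⊎ a ≡ d) ⊎ (b ≡ c ⊎ b ≡ d)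
¬disjoint⇒meet {a = a} {b} {c} {d} ¬dis with a Fin.≟ c | a Fin.≟ d | b Fin.≟ c | b Fin.≟ d
... | yes e | _     | _     | _     = inj₁ (inj₁ e)
... | no _  | yes e | _     | _     = inj₁ (inj₂ e)
... | no _  | no _  | yes e | _     = inj₂ (inj₁ e)
... | no _  | no _  | no _  | yes e = inj₂ (inj₂ e)
... | no p  | no q  | no r  | no s  = contradiction (p , q , r , s) ¬dis

rotate : {G : Graph V} → Cycle G k → Cycle G k
rotate C = record
  { 3≤k       = 3≤k C
  ; vertex    = vertex C ∘ next
  ; injective = next-injective ∘ injective C
  ; adjacent  = adjacent C ∘ next
  }

rotate-edge : {G : Graph V} (C : Cycle G k) → ∀ u v → CycleEdge (rotate C) u v ⇔ CycleEdge C u v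
rotate-edge C u v = mk⇔ (λ (i , e) → next i , e) from
  where
  from : CycleEdge C u v → CycleEdge (rotate C) u v
  from (i , e) with next-surjective i
  ... | j , refl = j , e

rotateTo : {G : Graph V} (i : Fin (suc m)) (C : Cycle G (suc m)) →
  Σ[ C′ ∈ Cycle G (suc m) ] (vertex C′ zero ≡ vertex C i × (∀ u v → CycleEdge C′ u v ⇔ CycleEdge C u v))
rotateTo {G = G} = <-weakInduction _ (λ C → C , refl , λ _ _ → ⇔-id _) λ i ih C →
  let C′ , e , same = ih (rotate C)
  in C′ , trans e (cong (vertex C) (next-inject₁ i)) , λ u v → rotate-edge C u v ⇔-∘ same u v

onCycle⇒cycleEdge : {G : Graph V} (C : Cycle G k) → ∀ {u} → OnCycle C u → ∃[ v ] CycleEdge C u v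
onCycle⇒cycleEdge C (i , e) = vertex C (next i) , i , inj₁ (e , refl)

onCycle-resp : {G : Graph V} (C : Cycle G k) (D : Cycle G l) →
  (∀ u v → CycleEdge C u v ⇔ CycleEdge D u v) → ∀ {u} → OnCycle C u → OnCycle D u
onCycle-resp C D same u∈C = let _ , e = onCycle⇒cycleEdge C u∈C
  in cycleEdge⇒onCycle D (Equivalence.to (same _ _) e)

-- Disjoint edges of `C` minus `v`, kept as families so that they can serve both as a matching of
-- `G` and, with proofs of membership, as one of `G` without the tree at `v`.
record PathMatching {G : Graph V} (C : Cycle G k) (v : V) (h : ℕ) : Set where
  field
    a b   : Fin h → V
    a∈C   : ∀ t → OnCycle C (a t)
    b∈C   : ∀ t → OnCycle C (b t)
    a≢v   : ∀ t → a t ≢ v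
    b≢v   : ∀ t → b t ≢ v
    ab    : ∀ t → Adj G (a t) (b t)
    apart : ∀ {t t′} → t ≢ t′ → Disjoint (a t , b t) (a t′ , b t′)

-- After rotating `C` to start at `v`, the positions are paired as (1,2), (3,4), up to (2h-1,2h).
-- Position 0 is left free, and parity tells first ends from second ends.
pathMatching : {G : Graph V} (C : Cycle G (suc m)) → ∀ {v} → OnCycle C v →
               ∀ {h} → 2 ℕ.* h ≤ m → PathMatching C v h
pathMatching {m = m} {G} C (i₀ , refl) {h} 2h≤m with rotateTo i₀ C
... | C′ , e₀ , same = record
  { a = vertex C′ ∘ ai
  ; b = vertex C′ ∘ bi
  ; a∈C = λ t → onCycle-resp C′ C same (ai t , refl)
  ; b∈C = λ t → onCycle-resp C′ C same (bi t , refl)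
  ; a≢v = λ t e → contradiction (injective C′ (trans e (sym e₀))) λ ()
  ; b≢v = λ t e → contradiction (injective C′ (trans e (sym e₀))) λ ()
  ; ab  = λ t → subst (Adj G (vertex C′ (ai t)) ∘ vertex C′) (next-a t) (adjacent C′ (ai t))
  ; apart = λ {t} {t′} t≢t′ →
        (λ e → t≢t′ (half (trans (sym (toℕ-a t)) (trans (index e) (toℕ-a t′)))))
      , (λ e → ℕ.even≢odd (toℕ t) (toℕ t′) (ℕ.suc-injective
          (trans (sym (toℕ-a t)) (trans (index e) (toℕ-b t′)))))
      , (λ e → ℕ.even≢odd (toℕ t′) (toℕ t) (ℕ.suc-injective
          (trans (sym (toℕ-a t′)) (trans (sym (index e)) (toℕ-b t)))))
      , λ e → t≢t′ (half (ℕ.suc-injective (trans (sym (toℕ-b t)) (trans (index e) (toℕ-b t′)))))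
  }
  where
  2+2t≤m : (t : Fin h) → suc (suc (2 ℕ.* toℕ t)) ≤ m
  2+2t≤m t = ℕ.≤-trans (ℕ.≤-reflexive (sym (ℕ.*-suc 2 (toℕ t))))
    (ℕ.≤-trans (ℕ.*-monoʳ-≤ 2 (Fin.toℕ<n t)) 2h≤m)

  ai bi : Fin h → Fin (suc m)
  ai t = suc (fromℕ< (ℕ.<-trans (ℕ.n<1+n _) (2+2t≤m t)))
  bi t = suc (fromℕ< (2+2t≤m t))

  toℕ-a : ∀ t → toℕ (ai t) ≡ suc (2 ℕ.* toℕ t)
  toℕ-a t = cong suc (Fin.toℕ-fromℕ< _)

  toℕ-b : ∀ t → toℕ (bi t) ≡ suc (suc (2 ℕ.* toℕ t))
  toℕ-b t = cong suc (Fin.toℕ-fromℕ< _)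

  next-a : ∀ t → next (ai t) ≡ bi t
  next-a t = Fin.toℕ-injective (trans
    (toℕ-next (ai t) (subst (_< m) (sym (toℕ-a t)) (2+2t≤m t)))
    (trans (cong suc (toℕ-a t)) (sym (toℕ-b t))))

  index : ∀ {i j} → vertex C′ i ≡ vertex C′ j → toℕ i ≡ toℕ j
  index e = cong toℕ (injective C′ e)

  half : ∀ {t t′ : Fin h} → suc (2 ℕ.* toℕ t) ≡ suc (2 ℕ.* toℕ t′) → t ≡ t′
  half e = Fin.toℕ-injective (ℕ.*-cancelˡ-≡ _ _ 2 (ℕ.suc-injective e))

record Enumeration (P : Pred (Fin n) 0ℓ) : Set where
  field
    count     : ℕ
    element   : Fin count → Fin n
    distinct  : Injective _≡_ _≡_ element
    sound     : ∀ i → P (element i)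
    complete  : ∀ {x} → P x → ∃[ i ] element i ≡ x

enumerate : {P : Pred (Fin n) 0ℓ} → Decidable P → Enumeration P
enumerate {zero} P? = record
  { count = 0 ; element = λ () ; distinct  = λ { {()} } ; sound = λ () ; complete = λ { {()} } }
enumerate {suc n} P? with enumerate (P? ∘ suc) | P? zero
... | E | yes p = record
  { count     = suc count
  ; element   = λ { zero → zero ; (suc i) → suc (element i) }
  ; distinct  = λ { {zero} {zero} _ → refl
                  ; {suc i} {suc j} e → cong suc (distinct (Fin.suc-injective e)) }
  ; sound     = λ { zero → p ; (suc i) → sound i }
  ; complete  = λ { {zero} _ → zero , refl
                  ; {suc x} q → let i , e = complete q in suc i , cong suc e }
  } where open Enumeration E
... | E | no ¬p = record
  { count     = count
  ; element   = suc ∘ element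
  ; distinct  = distinct ∘ Fin.suc-injective
  ; sound     = sound
  ; complete  = λ { {zero} q → contradiction q ¬p
                  ; {suc x} q → let i , e = complete q in i , cong suc e }
  } where open Enumeration E

≅-from : {G : Graph V} {H : Graph W} (g : W → V) → Injective _≡_ _≡_ g → (∀ v → ∃[ w ] g w ≡ v) →
         (∀ i j → Adj H i j ⇔ Adj G (g i) (g j)) → G ≅ H
≅-from {G = G} {H} g g-inj g-surj same = record
  { bijection = mk↔ₛ′ (proj₁ ∘ g-surj) g (λ w → g-inj (proj₂ (g-surj (g w)))) (proj₂ ∘ g-surj)
  ; preserves = λ u v → mk⇔
      (λ uv → Equivalence.from (same _ _)
        (subst₂ (Adj G) (sym (proj₂ (g-surj u))) (sym (proj₂ (g-surj v))) uv))
      (λ ij → subst₂ (Adj G) (proj₂ (g-surj u)) (proj₂ (g-surj v)) (Equivalence.to (same _ _) ij))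
  }

module _ (H : Graph (Fin n)) {v c : Fin n} (c∈T : Star (Adj H) v c)
         (centre : ∀ {p q} → Star (Adj H) v p → Adj H p q → p ≡ c ⊎ q ≡ c) where

  -- Invariant of a walk in the component: since every edge has `c` as an end, a step from a
  -- neighbour of `c` leads to `c`, and a step from `c` leads to a neighbour.
  spoke : ∀ {x w} → x ≡ c ⊎ Adj H c x → Star (Adj H) v x → Star (Adj H) x w → w ≡ c ⊎ Adj H c w
  spoke x∼c x∈T ε = x∼c
  spoke x∼c x∈T (xy ◅ walk) with centre x∈T xy
  ... | inj₁ refl = spoke (inj₂ xy) (x∈T ◅◅ (xy ◅ ε)) walk
  ... | inj₂ refl = spoke (inj₁ refl) (x∈T ◅◅ (xy ◅ ε)) walk

  component-isStar : IsStar (induced H (Star (Adj H) v))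
  component-isStar = suc count , ≅-from g g-injective g-surjective same
    where
    open Enumeration (enumerate (adj? H c))

    g : Fin (suc count) → Refinement (Fin n) (Star (Adj H) v)
    g zero    = c , [ c∈T ]
    g (suc i) = element i , [ c∈T ◅◅ (sound i ◅ ε) ]

    g-injective : Injective _≡_ _≡_ g
    g-injective {zero}  {zero}  _ = refl
    g-injective {zero}  {suc j} e = contradiction (sound j) (irrefl H (cong value e))
    g-injective {suc i} {zero}  e = contradiction (sound i) (irrefl H (sym (cong value e)))
    g-injective {suc i} {suc j} e = cong suc (distinct (cong value e))

    leaf : ∀ {w} → w ≢ c → Star (Adj H) v w → Adj H c w
    leaf w≢c w∈T with spoke (inj₁ refl) c∈T (Star.reverse (symm H) c∈T ◅◅ w∈T)
    ... | inj₁ w≡c = contradiction w≡c w≢c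
    ... | inj₂ cw  = cw

    g-surjective : ∀ w → ∃[ i ] g i ≡ w
    g-surjective (w , [ w∈T ]) with w Fin.≟ c
    ... | yes refl = zero , refl
    -- The proof that `w` lies in the component is irrelevant, so adjacency to `c` is recovered from
    -- its decision procedure.
    ... | no w≢c   = let i , e = complete (recompute (adj? H c w) (leaf w≢c w∈T))
                     in suc i , value-injective e

    same : ∀ i j → Adj (star (suc count)) i j ⇔ Adj H (value (g i)) (value (g j))
    same zero zero = mk⇔ (λ (0≢0 , _) → contradiction refl 0≢0)
      (λ cc → contradiction cc (irrefl H refl))
    same zero (suc j) = mk⇔ (λ _ → sound j) (λ _ → (λ ()) , inj₁ refl)
    same (suc i) zero = mk⇔ (λ _ → symm H (sound i)) (λ _ → (λ ()) , inj₂ refl)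
    same (suc i) (suc j) = mk⇔ (λ { (_ , inj₁ ()) ; (_ , inj₂ ()) }) λ ij →
      contradiction (centre (c∈T ◅◅ (sound i ◅ ε)) ij)
        [ (λ e → irrefl H (sym e) (sound i)) , (λ e → irrefl H (sym e) (sound j)) ]′

∉-edges⇒disjoint : ∀ {u v : V} {es : List (V × V)} → All (λ (p , q) → u ≢ p × u ≢ q) es →
                   All (λ (p , q) → v ≢ p × v ≢ q) es → All (Disjoint (u , v)) es
∉-edges⇒disjoint [] [] = []
∉-edges⇒disjoint ((p , q) ∷ u∉) ((r , s) ∷ v∉) = (p , q , r , s) ∷ ∉-edges⇒disjoint u∉ v∉

¬covers⇒∉ : {G : Graph V} (M : Matching G) → ∀ {v} → ¬ Covers M v →
            All (λ (p , q) → v ≢ p × v ≢ q) (edges M)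
¬covers⇒∉ M ¬c = All.map (λ ¬pq → ¬pq ∘ inj₁ , ¬pq ∘ inj₂) (All.¬Any⇒All¬ _ ¬c)

-- What the rank bound says about the trees and the edges off the cycle

module RankBound {G : Graph (Fin n)} (σ : Orientation G) (C : Cycle G (suc m)) (unique : IsUniqueCycle C)
                 (rank : SkewRank σ (suc h ℕ.* 2)) (2h≤m : 2 ℕ.* h ≤ m) where

  open Unicyclic C unique

  H = deleteCycleEdges C

  bound : ∀ {v} → OnCycle C v → (M : Matching G) →
          All (λ (a , b) → CycleEdge C a b → v ≢ a × v ≢ b) (edges M) → size M ≤ suc h
  bound v∈C M avoid = ℕ.*-cancelʳ-≤ _ _ 2 (matching-bound σ C unique rank v∈C M avoid)

  H-irrefl : ∀ {u v} → Adj H u v → u ≢ v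
  H-irrefl uv refl = irrefl H refl uv

  module AtVertex {v} (v∈C : OnCycle C v) where

    T = treeAt C v
    R = withoutTreeAt C v

    open PathMatching (pathMatching C v∈C {h} 2h≤m)

    fromTree : Matching T → Matching G
    fromTree = mapMatching value value-injective proj₁

    fromRest : Matching R → Matching G
    fromRest = mapMatching value value-injective id

    apart-from-tree : ∀ (x : Refinement (Fin n) (InTreeAt C v))
                      (y : Refinement (Fin n) (∁ (InTreeAt C v))) → value x ≢ value y
    apart-from-tree (x , [ x∈T ]) (_ , [ x∉T ]) refl = ⊥-elim-irr (x∉T x∈T)

    -- `matching-bound` applies at `v`: edges of the tree are not cycle edges, and edges of the rest
    -- do not touch `v`.
    tree+rest≤ : (M : Matching T) (N : Matching R) → size M ℕ.+ size N ≤ suc h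
    tree+rest≤ M N = subst (_≤ suc h)
      (trans (length-++ (edges (fromTree M))) (cong₂ ℕ._+_ (length-map _ (edges M)) (length-map _ (edges N))))
      (bound v∈C (fromTree M ∪ fromRest N [ All.map⁺ (All.universal (λ (a , b) →
          All.map⁺ (All.universal (λ (c , d) → apart-from-tree a c , apart-from-tree a d
                                             , apart-from-tree b c , apart-from-tree b d) _)) _) ])
        (All.++⁺
          (All.map⁺ (All.map (λ (_ , ¬c) c → contradiction c ¬c) (areEdges M)))
          (All.map⁺ (All.universal (λ (c , d) _ → apart-from-tree (root C v) c , apart-from-tree (root C v) d) _))))

    restPath : Matching R
    restPath = tabulateMatching
      (λ t → a t , [ a≢v t ∘ sym ∘ tree∩cycle v∈C (a∈C t) ])
      (λ t → b t , [ b≢v t ∘ sym ∘ tree∩cycle v∈C (b∈C t) ])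
      ab
      λ t≢t′ → let p , q , r , s = apart t≢t′ in
        p ∘ cong value , q ∘ cong value , r ∘ cong value , s ∘ cong value

    restPath-size : size restPath ≡ h
    restPath-size = length-tabulate _

    tree≤1 : (M : Matching T) → size M ≤ 1
    tree≤1 M = ℕ.+-cancelʳ-≤ h (size M) 1
      (subst (λ x → size M ℕ.+ x ≤ suc h) restPath-size (tree+rest≤ M restPath))

    tree-edges-meet : ∀ {p q p′ q′} → InTreeAt C v p → Adj H p q → InTreeAt C v p′ → Adj H p′ q′ →
                      ¬ Disjoint (p , q) (p′ , q′)
    tree-edges-meet p∈T pq p′∈T p′q′ (d₁ , d₂ , d₃ , d₄) = contradiction (tree≤1
      (insertEdge {u = _ , [ p∈T ]} {v = _ , [ p∈T ◅◅ (pq ◅ ε) ]} pq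
        (insertEdge {u = _ , [ p′∈T ]} {v = _ , [ p′∈T ◅◅ (p′q′ ◅ ε) ]} p′q′ ∅ [])
        ((d₁ ∘ cong value , d₂ ∘ cong value , d₃ ∘ cong value , d₄ ∘ cong value) ∷ []))) λ { (s≤s ()) }

    isolated : ¬ (∃[ x ] Adj H v x) → ∀ {p q} → InTreeAt C v p → ¬ Adj H p q
    isolated ¬x ε pq        = ¬x (_ , pq)
    isolated ¬x (vx ◅ _) pq = ¬x (_ , vx)

    -- If `v` had no neighbour in its tree, the tree would have no edge, and the empty matching
    -- would be maximum without covering `v`.
    saturated⇒neighbour : Saturated T (root C v) → ∃[ x ] Adj H v x
    saturated⇒neighbour sat with Fin.any? (adj? H v)
    ... | yes x = x
    ... | no ¬x = contradiction (sat ∅ maximum) λ ()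
      where
      maximum : (M : Matching T) → size M ≤ 0
      maximum record { edges = [] } = z≤n
      maximum record { edges = ((_ , [ p∈T ]) , _) ∷ _ ; areEdges = pq ∷ _ } =
        ⊥-elim-irr (isolated ¬x p∈T pq)

    -- Any two edges of the tree meet. If `v` is the only neighbour of `x`, every edge meets `v x`
    -- and hence contains `v`, the centre. Otherwise some `x y` with `y ≢ v` is an edge too. An edge
    -- meeting both `v x` and `x y` but missing `x` would be `v y`, giving a triangle of non-cycle
    -- edges; so `x` is the centre.
    tree-isStar : ∃[ x ] Adj H v x → IsStar T
    tree-isStar (x , vx) with Fin.any? (λ y → ¬? (y Fin.≟ v) ×-dec adj? H x y)
    ... | no ¬y = component-isStar H ε centre
      where
      atX : ∀ {y} → Adj H x y → y ≡ v
      atX {y} xy = decidable-stable (y Fin.≟ v) λ y≢v → ¬y (y , y≢v , xy)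

      centre : ∀ {p q} → InTreeAt C v p → Adj H p q → p ≡ v ⊎ q ≡ v
      centre p∈T pq with ¬disjoint⇒meet (tree-edges-meet p∈T pq ε vx)
      ... | inj₁ (inj₁ p≡v)  = inj₁ p≡v
      ... | inj₁ (inj₂ refl) = inj₂ (atX pq)
      ... | inj₂ (inj₁ q≡v)  = inj₂ q≡v
      ... | inj₂ (inj₂ refl) = inj₁ (atX (symm H pq))
    ... | yes (y , y≢v , xy) = component-isStar H (vx ◅ ε) centre
      where
      x≢v : x ≢ v
      x≢v = H-irrefl vx ∘ sym

      triangle : ¬ Adj H v y
      triangle (vy , ¬c) = bridge vy ¬c
        ( (symm G (proj₁ xy) , (λ (y≡v , _) → y≢v y≡v) , λ (_ , x≡v) → x≢v x≡v)
        ◅ (symm G (proj₁ vx) , (λ (x≡v , _) → x≢v x≡v) , λ (x≡y , _) → H-irrefl xy x≡y)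
        ◅ ε)

      centre : ∀ {p q} → InTreeAt C v p → Adj H p q → p ≡ x ⊎ q ≡ x
      centre p∈T pq with ¬disjoint⇒meet (tree-edges-meet p∈T pq ε vx)
                       | ¬disjoint⇒meet (tree-edges-meet p∈T pq (vx ◅ ε) xy)
      ... | inj₁ (inj₂ p≡x)  | _                 = inj₁ p≡x
      ... | inj₂ (inj₂ q≡x)  | _                 = inj₂ q≡x
      ... | _                | inj₁ (inj₁ p≡x)   = inj₁ p≡x
      ... | _                | inj₂ (inj₁ q≡x)   = inj₂ q≡x
      ... | inj₁ (inj₁ refl) | inj₁ (inj₂ v≡y)   = contradiction (sym v≡y) y≢v
      ... | inj₁ (inj₁ refl) | inj₂ (inj₂ refl)  = contradiction pq triangle
      ... | inj₂ (inj₁ refl) | inj₁ (inj₂ refl)  = contradiction (symm H pq) triangle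
      ... | inj₂ (inj₁ refl) | inj₂ (inj₂ v≡y)   = contradiction (sym v≡y) y≢v

    -- `restPath` attains `h`, and the edge `v x` of the tree, added to any matching of the rest,
    -- shows that `h` cannot be exceeded.
    rest-matchingNumber : ∃[ x ] Adj H v x → MatchingNumber R h
    rest-matchingNumber (x , vx) = restPath
      , (λ N → subst (size N ≤_) (sym restPath-size) (ℕ.≤-pred (tree+rest≤ single N)))
      , restPath-size
      where
      single : Matching T
      single = insertEdge {u = root C v} {v = x , [ vx ◅ ε ]} vx ∅ []

  _∉C : Fin n → Set
  v ∉C = ¬ OnCycle C v

  onCycle : ∀ i → OnCycle C (vertex C i)
  onCycle i = i , refl

  -- Two disjoint edges off `C`, together with `h` disjoint edges of `C` that miss its vertex 0,
  -- would make a matching of size `h + 2` to which `bound` applies.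
  outside-edges-meet : ∀ {p q p′ q′} → p ∉C → q ∉C → Adj G p q → p′ ∉C → q′ ∉C → Adj G p′ q′ →
                       ¬ Disjoint (p , q) (p′ , q′)
  outside-edges-meet {p} {q} {p′} {q′} p∉ q∉ pq p′∉ q′∉ p′q′ dis = contradiction
    (bound (onCycle zero) M ((λ c → contradiction (cycleEdge⇒onCycle C c) p∉)
      ∷ (λ c → contradiction (cycleEdge⇒onCycle C c) p′∉)
      ∷ All.tabulate⁺ λ t _ → a≢v t ∘ sym , b≢v t ∘ sym))
    (ℕ.<⇒≱ (s≤s (s≤s (ℕ.≤-reflexive (sym (length-tabulate (λ t → a t , b t)))))))
    where
    open PathMatching (pathMatching C (onCycle zero) {h} 2h≤m)

    off : ∀ {u v} → u ∉C → OnCycle C v → u ≢ v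
    off u∉ v∈ refl = u∉ v∈

    off-path : ∀ {u v} → u ∉C → v ∉C → All (Disjoint (u , v)) (tabulate λ t → a t , b t)
    off-path u∉ v∉ = All.tabulate⁺ λ t → off u∉ (a∈C t) , off u∉ (b∈C t) , off v∉ (a∈C t) , off v∉ (b∈C t)

    M : Matching G
    M = insertEdge pq (insertEdge p′q′ (tabulateMatching a b ab apart) (off-path p′∉ q′∉))
          (dis ∷ off-path p∉ q∉)

  off-H : ∀ {u v} → u ∉C → Adj G u v → Adj H u v
  off-H u∉ uv = uv , u∉ ∘ cycleEdge⇒onCycle C

  -- With two neighbours on `C`, the vertex `u` would have a detour around the edge `u v` along `C`.
  attached-once : ∀ {u v w} → u ∉C → OnCycle C v → OnCycle C w → Adj G v u → Adj G w u → w ≡ v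
  attached-once {u} {v} {w} u∉ v∈ w∈ vu wu = decidable-stable (w Fin.≟ v) λ w≢v →
    bridge (symm G vu) ¬c
      (alongCycleAvoiding ¬c v∈ w∈ ◅◅ ((wu , (λ { (refl , _) → u∉ w∈ }) , λ (w≡v , _) → w≢v w≡v) ◅ ε))
    where
    ¬c : ¬ CycleEdge C u v
    ¬c = u∉ ∘ cycleEdge⇒onCycle C

  covers? : ∀ {v} (M : Matching (treeAt C v)) x → Dec (Covers M x)
  covers? M x = Any.any? (λ (p , q) → dec x p ⊎-dec dec x q) (edges M)
    where
    dec : ∀ {v} (x y : Refinement (Fin n) (InTreeAt C v)) → Dec (x ≡ y)
    dec x y with value x Fin.≟ value y
    ... | yes e = yes (value-injective e)
    ... | no ¬e = no (¬e ∘ cong value)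

  -- Otherwise v is the only neighbour of u, and a maximum matching of G{v} that leaves v uncovered
  -- extends by the edge v u.
  unsaturated⇒extends : ∀ {v u} → OnCycle C v → ¬ Saturated (treeAt C v) (root C v) →
                        u ∉C → Adj G v u → ∃[ w ] (w ∉C × Adj G u w)
  unsaturated⇒extends {v} {u} v∈ unsat u∉ vu with Fin.any? (λ w → ¬? (onCycle? w) ×-dec adj? G u w)
  ... | yes w = w
  ... | no ¬w = contradiction saturated unsat
    where
    atU : ∀ {w} → Adj G u w → w ≡ v
    atU {w} uw = attached-once u∉ v∈ (decidable-stable (onCycle? w) λ w∉ → ¬w (w , w∉ , uw)) vu (symm G uw)

    vuᴴ : Adj H v u
    vuᴴ = symm H (off-H u∉ (symm G vu))

    saturated : Saturated (treeAt C v) (root C v)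
    saturated M max = decidable-stable (covers? M (root C v)) λ ¬cov →
      let v∉M = ¬covers⇒∉ M ¬cov in
      ℕ.n≮n _ (max (insertEdge {u = root C v} {v = u , [ vuᴴ ◅ ε ]} vuᴴ M (∉-edges⇒disjoint v∉M
        (All.zipWith (λ { ((v≢p , v≢q) , (pq , _)) →
            (λ { refl → v≢q (value-injective (sym (atU pq))) })
          , (λ { refl → v≢p (value-injective (sym (atU (symm G pq)))) }) }) (v∉M , areEdges M)))))

  -- A matching of G{v} missing v lies outside C, so it has at most one edge, but v u and w y are
  -- disjoint.
  longPath⇒saturated : ∀ {v u w y} → OnCycle C v → Adj G v u → u ∉C → Adj G u w → w ∉C →
                       Adj G w y → y ≢ u → y ∉C → Saturated (treeAt C v) (root C v)
  longPath⇒saturated {v} {u} {w} {y} v∈ vu u∉ uw w∉ wy y≢u y∉ M max =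
    decidable-stable (covers? M (root C v)) λ ¬cov →
      contradiction (max two) (ℕ.<⇒≱ (s≤s (atMostOne M (¬covers⇒∉ M ¬cov))))
    where
    T = treeAt C v

    vuᴴ : Adj H v u
    vuᴴ = symm H (off-H u∉ (symm G vu))

    u∈T = vuᴴ ◅ ε
    w∈T = u∈T ◅◅ (off-H u∉ uw ◅ ε)

    off : ∀ {x y} → OnCycle C x → y ∉C → x ≢ y
    off x∈ y∉ refl = y∉ x∈

    two : Matching T
    two = insertEdge {u = root C v} {v = u , [ u∈T ]} vuᴴ
      (insertEdge {u = w , [ w∈T ]} {v = y , [ w∈T ◅◅ (off-H w∉ wy ◅ ε) ]} (off-H w∉ wy) ∅ [])
      (( off v∈ w∉ ∘ cong value , off v∈ y∉ ∘ cong value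
       , (λ e → irrefl G (cong value e) uw) , y≢u ∘ sym ∘ cong value) ∷ [])

    outside : ∀ (x : Refinement (Fin n) (InTreeAt C v)) → root C v ≢ x → value x ∉C
    outside (x , [ x∈T ]) v≢x x∈C = ⊥-elim-irr (v≢x (value-injective (tree∩cycle v∈ x∈C x∈T)))

    atMostOne : (N : Matching T) → All (λ (p , q) → root C v ≢ p × root C v ≢ q) (edges N) → size N ≤ 1
    atMostOne record { edges = [] } _ = z≤n
    atMostOne record { edges = _ ∷ [] } _ = s≤s z≤n
    atMostOne record { edges = (p , q) ∷ (p′ , q′) ∷ _ ; areEdges = pq ∷ p′q′ ∷ _
                     ; disjoint = ((d₁ , d₂ , d₃ , d₄) ∷ _) ∷ _ } ((v≢p , v≢q) ∷ (v≢p′ , v≢q′) ∷ _) =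
      contradiction (d₁ ∘ value-injective , d₂ ∘ value-injective , d₃ ∘ value-injective , d₄ ∘ value-injective)
        (outside-edges-meet (outside p v≢p) (outside q v≢q) (proj₁ pq)
          (outside p′ v≢p′) (outside q′ v≢q′) (proj₁ p′q′))

-- The case of no saturated cycle vertex

-- The shape of U* seen inside `G`: `v` is the cycle vertex that carries the star, `u` the centre of
-- the star and `w` one of its leaves.
record Attachment {G : Graph (Fin n)} (C : Cycle G k) : Set where
  field
    {v u w} : Fin n
    v∈C     : OnCycle C v
    u∉C     : ¬ OnCycle C u
    w∉C     : ¬ OnCycle C w
    vu      : Adj G v u
    uw      : Adj G u w
    through : ∀ {p q} → ¬ OnCycle C p → ¬ OnCycle C q → Adj G p q → p ≡ u ⊎ q ≡ u
    only    : ∀ {x y} → OnCycle C y → ¬ OnCycle C x → Adj G y x → x ≡ u × y ≡ v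
    spokes  : ∀ {x} → ¬ OnCycle C x → x ≢ u → Adj G u x

module _ {G : Graph (Fin n)} (σ : Orientation G) (C : Cycle G (suc m)) (unique : IsUniqueCycle C)
         (rank : SkewRank σ (suc h ℕ.* 2)) (2h≤m : 2 ℕ.* h ≤ m) (connected : Connected G) (k<n : suc m < n)
         (unsaturated : ∀ v → OnCycle C v → ¬ Saturated (treeAt C v) (root C v)) where

  open Unicyclic C unique
  open RankBound {h = h} σ C unique rank 2h≤m

  outsider : ∃[ x ] x ∉C
  outsider with Fin.any? (λ x → ¬? (onCycle? x))
  ... | yes x = x
  ... | no ¬x = contradiction (Fin.injective⇒≤ position-injective) (ℕ.<⇒≱ k<n)
    where
    position : ∀ x → OnCycle C x
    position x = decidable-stable (onCycle? x) λ x∉ → ¬x (x , x∉)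

    position-injective : Injective _≡_ _≡_ (proj₁ ∘ position)
    position-injective {x} {y} e =
      trans (sym (proj₂ (position x))) (trans (cong (vertex C) e) (proj₂ (position y)))

  leaving : ∀ {x y} → OnCycle C x → y ∉C → Star (Adj G) x y →
            ∃[ v ] ∃[ u ] (OnCycle C v × u ∉C × Adj G v u)
  leaving x∈ y∉ ε = contradiction x∈ y∉
  leaving x∈ y∉ (_◅_ {j = z} xz walk) with onCycle? z
  ... | yes z∈ = leaving z∈ y∉ walk
  ... | no z∉  = _ , z , x∈ , z∉ , xz

  module Attach {v u w} (v∈ : OnCycle C v) (u∉ : u ∉C) (w∉ : w ∉C) (vu : Adj G v u) (uw : Adj G u w) where

    far : ∀ {y} → y ∉C → Adj G w y → y ≡ u
    far {y} y∉ wy = decidable-stable (y Fin.≟ u) λ y≢u →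
      unsaturated v v∈ (longPath⇒saturated v∈ vu u∉ uw w∉ wy y≢u y∉)

    -- An edge off `C` must meet `u w`. If it does so at `w`, its other end is `u` by `far`.
    through : ∀ {p q} → p ∉C → q ∉C → Adj G p q → p ≡ u ⊎ q ≡ u
    through {p} {q} p∉ q∉ pq = cases (¬disjoint⇒meet (outside-edges-meet p∉ q∉ pq u∉ w∉ uw))
      where
      cases : (p ≡ u ⊎ p ≡ w) ⊎ (q ≡ u ⊎ q ≡ w) → p ≡ u ⊎ q ≡ u
      cases (inj₁ (inj₁ p≡u)) = inj₁ p≡u
      cases (inj₁ (inj₂ p≡w)) = inj₂ (far q∉ (subst (λ x → Adj G x q) p≡w pq))
      cases (inj₂ (inj₁ q≡u)) = inj₂ q≡u
      cases (inj₂ (inj₂ q≡w)) = inj₁ (far p∉ (symm G (subst (Adj G p) q≡w pq)))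

    -- Otherwise the edge `x u` has the detour from `u` to `v`, along `C` to `y`, and on to `x`.
    pendant : ∀ {x y} → OnCycle C y → x ∉C → Adj G y x → x ≢ u → ¬ Adj G x u
    pendant {x} {y} y∈ x∉ yx x≢u xu = bridge xu ¬c
      ( (symm G vu , (λ (u≡x , _) → x≢u (sym u≡x)) , λ (_ , v≡x) → x∉ (subst (OnCycle C) v≡x v∈))
      ◅ alongCycleAvoiding ¬c v∈ y∈
      ◅◅ ((yx , (λ (y≡x , _) → x∉ (subst (OnCycle C) y≡x y∈))
              , λ (y≡u , _) → u∉ (subst (OnCycle C) y≡u y∈)) ◅ ε))
      where
      ¬c : ¬ CycleEdge C x u
      ¬c = x∉ ∘ cycleEdge⇒onCycle C

    -- As `y` is unsaturated, `x` has a neighbour `z` off `C`. The edge `x z` contains `u`, and `z`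
    -- cannot be `u` by `pendant`.
    only-u : ∀ {x y} → OnCycle C y → x ∉C → Adj G y x → x ≡ u
    only-u {x} {y} y∈ x∉ yx = decidable-stable (x Fin.≟ u) λ x≢u →
      let z , z∉ , xz = unsaturated⇒extends y∈ (unsaturated y y∈) x∉ yx in
      [ x≢u , (λ z≡u → pendant y∈ x∉ yx x≢u (subst (Adj G x) z≡u xz)) ]′ (through x∉ z∉ xz)

    only : ∀ {x y} → OnCycle C y → x ∉C → Adj G y x → x ≡ u × y ≡ v
    only {x} {y} y∈ x∉ yx = x≡u , attached-once u∉ v∈ y∈ vu (subst (Adj G y) x≡u yx)
      where x≡u = only-u y∈ x∉ yx

    -- Invariant of a walk in `G`. By connectedness it places every vertex off `C` at `u` or next to
    -- `u`.
    reach : ∀ {x y} → OnCycle C x ⊎ x ≡ u ⊎ Adj G u x → Star (Adj G) x y → OnCycle C y ⊎ y ≡ u ⊎ Adj G u y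
    reach x∼ ε = x∼
    reach x∼ (_◅_ {i = x} {j = z} xz walk) with onCycle? x | onCycle? z
    ... | _      | yes z∈ = reach (inj₁ z∈) walk
    ... | yes x∈ | no z∉  = reach (inj₂ (inj₁ (only-u x∈ z∉ xz))) walk
    ... | no x∉  | no z∉  = reach
      ([ (λ x≡u → inj₂ (inj₂ (subst (λ y → Adj G y z) x≡u xz))) , inj₂ ∘ inj₁ ]′ (through x∉ z∉ xz)) walk

    attach : Attachment C
    attach = record
      { v∈C = v∈ ; u∉C = u∉ ; w∉C = w∉ ; vu = vu ; uw = uw
      ; through = through ; only = only ; spokes = λ x∉ x≢u →
          [ (λ x∈ → contradiction x∈ x∉) , [ (λ x≡u → contradiction x≡u x≢u) , id ]′ ]′
            (reach (inj₁ v∈) (connected v _)) }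

  attachment : Attachment C
  attachment =
    let _ , _ , v∈ , u∉ , vu = leaving (onCycle zero) (proj₂ outsider) (connected _ _)
        _ , w∉ , uw = unsaturated⇒extends v∈ (unsaturated _ v∈) u∉ vu
    in Attach.attach v∈ u∉ w∉ vu uw

-- The isomorphism with U*

module _ {G : Graph (Fin n)} (C : Cycle G (suc m)) (unique : IsUniqueCycle C) (att : Attachment C) where

  open Unicyclic C unique
  open Attachment att

  attachment⇒U* : G ≅ U* (suc m) (n ∸ suc m)
  -- The cycle is rotated so that `v` becomes its vertex 0, where U* attaches the star.
  attachment⇒U* with rotateTo (proj₁ v∈C) C
  ... | C′ , start , sameEdges = subst (λ x → G ≅ U* (suc m) x) (sym size≡) iso
    where
    open Enumeration (enumerate (λ x → ¬? (onCycle? x) ×-dec ¬? (x Fin.≟ u)))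

    g : Fin (suc m) ⊎ Fin (suc count) → Fin n
    g (inj₁ i)       = vertex C′ i
    g (inj₂ zero)    = u
    g (inj₂ (suc j)) = element j

    v₀ : vertex C′ zero ≡ v
    v₀ = trans start (proj₂ v∈C)

    on : ∀ i → OnCycle C (vertex C′ i)
    on i = onCycle-resp C′ C sameEdges (i , refl)

    off : ∀ j → ¬ OnCycle C (g (inj₂ j))
    off zero    = u∉C
    off (suc j) = proj₁ (sound j)

    on≢off : ∀ i j → g (inj₁ i) ≢ g (inj₂ j)
    on≢off i j e = off j (subst (OnCycle C) e (on i))

    g-injective : Injective _≡_ _≡_ g
    g-injective {inj₁ i} {inj₁ j} e = cong inj₁ (injective C′ e)
    g-injective {inj₁ i} {inj₂ j} e = contradiction e (on≢off i j)
    g-injective {inj₂ i} {inj₁ j} e = contradiction (sym e) (on≢off j i)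
    g-injective {inj₂ zero} {inj₂ zero} e = refl
    g-injective {inj₂ zero} {inj₂ (suc j)} e = contradiction (sym e) (proj₂ (sound j))
    g-injective {inj₂ (suc i)} {inj₂ zero} e = contradiction e (proj₂ (sound i))
    g-injective {inj₂ (suc i)} {inj₂ (suc j)} e = cong (inj₂ ∘ suc) (distinct e)

    g-surjective : ∀ x → ∃[ i ] g i ≡ x
    g-surjective x with onCycle? x | x Fin.≟ u
    ... | yes x∈ | _ = let i , e = onCycle-resp C C′
                             (λ p q → ⇔-sym (sameEdges p q)) x∈
                       in inj₁ i , e
    ... | no _   | yes refl = inj₂ zero , refl
    ... | no x∉  | no x≢u   = let j , e = complete (x∉ , x≢u) in inj₂ (suc j) , e

    U = U* (suc m) (suc count)

    Same : (i j : Fin (suc m) ⊎ Fin (suc count)) → Set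
    Same i j = Adj U i j ⇔ Adj G (g i) (g j)

    same-sym : ∀ i j → Same i j → Same j i
    same-sym i j s = mk⇔
      (λ ji → symm G (Equivalence.to s (symm U {j} {i} ji)))
      (λ ji → symm U {i} {j} (Equivalence.from s (symm G ji)))

    same-mixed : ∀ i j → Same (inj₁ i) (inj₂ j)
    same-mixed i zero = mk⇔
      (λ { (i≡0 , _) → subst (λ x → Adj G x u)
             (trans (sym v₀) (cong (vertex C′) (Fin.toℕ-injective (sym i≡0)))) vu })
      (λ iu → cong toℕ (injective C′ (trans (proj₂ (only (on i) u∉C iu)) (sym v₀))) , refl)
    same-mixed i (suc j) = mk⇔ (λ ())
      (λ ij → contradiction (proj₁ (only (on i) (off (suc j)) ij)) (proj₂ (sound j)))

    same : ∀ i j → Same i j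
    same (inj₁ i) (inj₁ j) = mk⇔
      (λ { (_ , inj₁ refl) → adjacent C′ i ; (_ , inj₂ refl) → symm G (adjacent C′ j) })
      (λ ij → (λ { refl → irrefl G refl ij })
            , neighbours (Equivalence.from (sameEdges _ _) (chordless (on i) (on j) ij)))
      where
      neighbours : CycleEdge C′ (vertex C′ i) (vertex C′ j) → next i ≡ j ⊎ next j ≡ i
      neighbours (l , inj₁ (p , q)) with refl ← injective C′ p = inj₁ (injective C′ q)
      neighbours (l , inj₂ (p , q)) with refl ← injective C′ p = inj₂ (injective C′ q)
    same (inj₁ i) (inj₂ j) = same-mixed i j
    same (inj₂ i) (inj₁ j) = same-sym (inj₁ j) (inj₂ i) (same-mixed j i)
    same (inj₂ zero) (inj₂ zero) = mk⇔ (λ (0≢0 , _) → contradiction refl 0≢0)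
      (λ uu → contradiction uu (irrefl G refl))
    same (inj₂ zero) (inj₂ (suc j)) = mk⇔ (λ _ → uncurry spokes (sound j)) (λ _ → (λ ()) , inj₁ refl)
    same (inj₂ (suc i)) (inj₂ zero) = mk⇔ (λ _ → symm G (uncurry spokes (sound i))) (λ _ → (λ ()) , inj₂ refl)
    same (inj₂ (suc i)) (inj₂ (suc j)) = mk⇔ (λ { (_ , inj₁ ()) ; (_ , inj₂ ()) }) λ ij →
      contradiction (through (off (suc i)) (off (suc j)) ij) [ proj₂ (sound i) , proj₂ (sound j) ]′

    iso : G ≅ U
    iso = ≅-from g g-injective g-surjective same

    -- The star consists of `u` and the enumerated leaves. The bijection underlying `iso` then
    -- forces `n` to be the sum of `suc m` and `suc count`.
    size≡ : n ∸ suc m ≡ suc count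
    size≡ = trans (cong (_∸ suc m) (↔⇒≡ (↔-sym Fin.+↔⊎ ↔-∘ _≅_.bijection iso))) (ℕ.m+n∸m≡n (suc m) (suc count))

-- The sign of an even cycle

-- Products along a sequence on ℕ, which can be shifted and extended past one turn of the cycle.
prod : (ℕ → ℚ) → ℕ → ℚ
prod b zero    = 1ℚ
prod b (suc t) = b 0 * prod (b ∘ suc) t

Πℚ≡prod : ∀ k (b : ℕ → ℚ) → Πℚ {k} (b ∘ toℕ) ≡ prod b k
Πℚ≡prod zero    b = refl
Πℚ≡prod (suc k) b = cong (b 0 *_) (Πℚ≡prod k (b ∘ suc))

prod-snoc : ∀ b t → prod b (suc t) ≡ prod b t * b t
prod-snoc b zero    = ℚ.*-comm (b 0) 1ℚ
prod-snoc b (suc t) = trans (cong (b 0 *_) (prod-snoc (b ∘ suc) t)) (sym (ℚ.*-assoc (b 0) _ _))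

prod-sign : ∀ b t → (∀ i → b i ≡ 1ℚ ⊎ b i ≡ - 1ℚ) → prod b t ≡ 1ℚ ⊎ prod b t ≡ - 1ℚ
prod-sign b zero    ±1 = inj₁ refl
prod-sign b (suc t) ±1 with ±1 0 | prod-sign (b ∘ suc) t (±1 ∘ suc)
... | inj₁ p | inj₁ q rewrite p | q = inj₁ refl
... | inj₁ p | inj₂ q rewrite p | q = inj₂ refl
... | inj₂ p | inj₁ q rewrite p | q = inj₂ refl
... | inj₂ p | inj₂ q rewrite p | q = inj₁ refl

-- Induction on `q`, with both sequences shifted by two.
two-step : ∀ (y b : ℕ → ℚ) → (∀ t → y (suc (suc t)) ≡ y t * b t * b (suc t)) →
           ∀ q → y (q ℕ.* 2) ≡ y 0 * prod b (q ℕ.* 2)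
two-step y b rec zero    = sym (ℚ.*-identityʳ (y 0))
two-step y b rec (suc q) = begin
  y (suc (suc (q ℕ.* 2)))             ≡⟨ two-step (λ t → y (suc (suc t))) (λ t → b (suc (suc t)))
                                           (λ t → rec (suc (suc t))) q ⟩
  y 2 * P                             ≡⟨ cong (_* P) (rec 0) ⟩
  y 0 * b 0 * b 1 * P                 ≡⟨ ℚ.*-assoc (y 0 * b 0) (b 1) P ⟩
  y 0 * b 0 * (b 1 * P)               ≡⟨ ℚ.*-assoc (y 0) (b 0) (b 1 * P) ⟩
  y 0 * (b 0 * (b 1 * P))             ∎
  where
  open ≡-Reasoning
  P = prod (λ t → b (suc (suc t))) (q ℕ.* 2)

≡*-1⇒≡0 : ∀ x → x ≡ x * - 1ℚ → x ≡ 0ℚ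
≡*-1⇒≡0 x e = begin
  x                       ≡⟨ ℚ.*-identityʳ x ⟨
  x * (½ + ½)             ≡⟨ ℚ.*-distribˡ-+ x ½ ½ ⟩
  x * ½ + x * ½           ≡⟨ cong (λ z → x * ½ + z * ½) e ⟩
  x * ½ + x * - 1ℚ * ½    ≡⟨ cong (x * ½ +_) (ℚ.*-assoc x (- 1ℚ) ½) ⟩
  x * ½ + x * - ½         ≡⟨ ℚ.*-distribˡ-+ x ½ (- ½) ⟨
  x * 0ℚ                  ≡⟨ ℚ.*-zeroʳ x ⟩
  0ℚ                      ∎
  where open ≡-Reasoning

module _ {G : Graph (Fin n)} (σ : Orientation G) (C : Cycle G (suc m)) (unique : IsUniqueCycle C) where

  open Skew σ
  open Unicyclic C unique

  -- Along the cycle the kernel equations read x(i+2) = x(i) a(i) a(i+1) with a(i) the sign of the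
  -- i-th edge, so going once around an even cycle multiplies x by its sign.
  oddlyOriented⇒kernel-trivial : 2 ∣ suc m → ¬ EvenlyOriented σ C → (x : Fin (suc m) → ℚ) →
    (∀ j → Σℚ (λ i → x i * S (vertex C i) (vertex C j)) ≡ 0ℚ) → ∀ i → x i ≡ 0ℚ
  oddlyOriented⇒kernel-trivial (divides q k≡q*2) ¬even x columns i =
    subst (λ j → x j ≡ 0ℚ) (at-toℕ i) (y≡0 (toℕ i))
    where
    open ≡-Reasoning

    a : Fin (suc m) → ℚ
    a i = S (vertex C i) (vertex C (next i))

    a² : ∀ i → a i * a i ≡ 1ℚ
    a² i = S²≡1 (adjacent C i)

    -- As `C` has no chords, the column of `next i` meets only the rows of its two cycle neighbours.
    -- By skew-symmetry the entry in the row of `next (next i)` is minus `a (next i)`.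
    balance : ∀ i → x (next (next i)) * a (next i) ≡ x i * a i
    balance i = sym (x∙y⁻¹≈ε⇒x≈y (x i * a i) (x (next (next i)) * a (next i)) (begin
      x i * a i + - (x (next (next i)) * a (next i))   ≡⟨ cong (x i * a i +_)
                                                            (ℚ.neg-distribʳ-* (x (next (next i))) (a (next i))) ⟩
      x i * a i + x (next (next i)) * - a (next i)     ≡⟨ cong (λ z → x i * a i + x (next (next i)) * z)
                                                            (S-antisym _ _) ⟨
      f i + f (next (next i))                          ≡⟨ sum-pair f (≢-sym (next²≢ (3≤k C) i)) other ⟨
      Σℚ f                                             ≡⟨ columns (next i) ⟩
      0ℚ                                               ∎))
      where
      f : Fin (suc m) → ℚ
      f l = x l * S (vertex C l) (vertex C (next i))

      other : ∀ l → l ≢ i → l ≢ next (next i) → f l ≡ 0ℚ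
      other l l≢i l≢nni = trans (cong (x l *_)
          (S-nonadj λ adj → nonadj (chordless (l , refl) (next i , refl) adj))) (ℚ.*-zeroʳ (x l))
        where
        nonadj : ¬ CycleEdge C (vertex C l) (vertex C (next i))
        nonadj (j , inj₁ (p , q)) = l≢i (trans (sym (injective C p)) (next-injective (injective C q)))
        nonadj (j , inj₂ (p , q)) = l≢nni (trans (sym (injective C q)) (cong next (injective C p)))

    step : ∀ i → x (next (next i)) ≡ x i * a i * a (next i)
    step i = begin
      x (next (next i))                               ≡⟨ ℚ.*-identityʳ _ ⟨
      x (next (next i)) * 1ℚ                          ≡⟨ cong (x (next (next i)) *_) (a² (next i)) ⟨
      x (next (next i)) * (a (next i) * a (next i))   ≡⟨ ℚ.*-assoc (x (next (next i))) _ _ ⟨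
      x (next (next i)) * a (next i) * a (next i)     ≡⟨ cong (_* a (next i)) (balance i) ⟩
      x i * a i * a (next i)                          ∎

    at : ℕ → Fin (suc m)
    at zero    = zero
    at (suc t) = next (at t)

    toℕ-at : ∀ {t} → t ≤ m → toℕ (at t) ≡ t
    toℕ-at {zero}  _   = refl
    toℕ-at {suc t} t<m = trans (toℕ-next (at t) (subst (_< m) (sym ih) t<m)) (cong suc ih)
      where ih = toℕ-at (ℕ.<⇒≤ t<m)

    at-toℕ : ∀ i → at (toℕ i) ≡ i
    at-toℕ i = Fin.toℕ-injective (toℕ-at (ℕ.≤-pred (Fin.toℕ<n i)))

    at-k : at (suc m) ≡ zero
    at-k = Fin.toℕ-injective (toℕ-next-last (at m) (toℕ-at ℕ.≤-refl))

    y b : ℕ → ℚ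
    y = x ∘ at
    b = a ∘ at

    -- Stated for arbitrary sequences because it is used a second time after a shift by one.
    around : ∀ y b → (∀ t → y (suc (suc t)) ≡ y t * b t * b (suc t)) → y (suc m) ≡ y 0 * prod b (suc m)
    around y b rec = subst (λ k → y k ≡ y 0 * prod b k) (sym k≡q*2) (two-step y b rec q)

    prod≡-1 : prod b (suc m) ≡ - 1ℚ
    prod≡-1 with prod-sign b (suc m) (λ t → S-adj (adjacent C (at t)))
    ... | inj₂ e = e
    ... | inj₁ e = contradiction (subst (0ℚ ℚ.<_) (sym (begin
            Πℚ a               ≡⟨ Πℚ-cong {suc m} (λ i → cong a (at-toℕ i)) ⟨
            Πℚ {suc m} (b ∘ toℕ)       ≡⟨ Πℚ≡prod (suc m) b ⟩
            prod b (suc m)     ≡⟨ e ⟩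
            1ℚ                 ∎)) (ℚ.positive⁻¹ 1ℚ)) ¬even

    -- Shifting by one drops the factor `b 0` and gains `b (suc m)`, which is `b 0` again. The
    -- calculation multiplies by the square of `b 0`, which is 1.
    shifted-prod≡-1 : prod (b ∘ suc) (suc m) ≡ - 1ℚ
    shifted-prod≡-1 = begin
      P                              ≡⟨ ℚ.*-identityˡ P ⟨
      1ℚ * P                         ≡⟨ cong (_* P) (a² zero) ⟨
      b 0 * b 0 * P                  ≡⟨ ℚ.*-assoc (b 0) (b 0) P ⟩
      b 0 * prod b (suc (suc m))     ≡⟨ cong (b 0 *_) (prod-snoc b (suc m)) ⟩
      b 0 * (prod b (suc m) * b (suc m)) ≡⟨ cong₂ (λ p i → b 0 * (p * a i)) prod≡-1 at-k ⟩
      b 0 * (- 1ℚ * b 0)             ≡⟨ cong (b 0 *_) (ℚ.*-comm (- 1ℚ) (b 0)) ⟩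
      b 0 * (b 0 * - 1ℚ)             ≡⟨ ℚ.*-assoc (b 0) (b 0) (- 1ℚ) ⟨
      b 0 * b 0 * - 1ℚ               ≡⟨ cong (_* - 1ℚ) (a² zero) ⟩
      - 1ℚ                           ∎
      where P = prod (b ∘ suc) (suc m)

    y≡0 : ∀ t → y t ≡ 0ℚ
    y≡0 zero = ≡*-1⇒≡0 (y 0) (begin
      y 0                       ≡⟨ cong x at-k ⟨
      y (suc m)                 ≡⟨ around y b (step ∘ at) ⟩
      y 0 * prod b (suc m)      ≡⟨ cong (y 0 *_) prod≡-1 ⟩
      y 0 * - 1ℚ                ∎)
    -- Steps of two around an even cycle preserve parity, so the odd positions need a starting value
    -- of their own.
    y≡0 (suc zero) = ≡*-1⇒≡0 (y 1) (begin
      y 1                               ≡⟨ cong (x ∘ next) at-k ⟨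
      y (suc (suc m))                   ≡⟨ around (y ∘ suc) (b ∘ suc) (step ∘ at ∘ suc) ⟩
      y 1 * prod (b ∘ suc) (suc m)      ≡⟨ cong (y 1 *_) shifted-prod≡-1 ⟩
      y 1 * - 1ℚ                        ∎)
    y≡0 (suc (suc t)) = begin
      y (suc (suc t))          ≡⟨ step (at t) ⟩
      y t * b t * b (suc t)    ≡⟨ cong (λ z → z * b t * b (suc t)) (y≡0 t) ⟩
      0ℚ * b t * b (suc t)     ≡⟨ cong (_* b (suc t)) (ℚ.*-zeroˡ (b t)) ⟩
      0ℚ * b (suc t)           ≡⟨ ℚ.*-zeroˡ (b (suc t)) ⟩
      0ℚ                       ∎

  -- If `C` were not evenly oriented, the `k + 2` chosen rows would be independent. Among them only
  -- the row of `u` meets column `w`, so `u` has coefficient 0. The columns of `C` then give the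
  -- kernel equations of the cycle alone, which have only the zero solution, and column `u` finally
  -- isolates `w`.
  attachment⇒evenlyOriented : 2 ∣ suc m → SkewRank σ (suc m) → Attachment C → EvenlyOriented σ C
  attachment⇒evenlyOriented 2∣k (_ , maximal) att = decidable-stable (_ ℚ.<? _) λ ¬even →
    contradiction (maximal ρ (independent ¬even)) (ℕ.<⇒≱ (ℕ.m<n⇒m<1+n (ℕ.n<1+n (suc m))))
    where
    open Attachment att

    ρ : Fin (suc (suc (suc m))) → Fin n
    ρ zero          = u
    ρ (suc zero)    = w
    ρ (suc (suc i)) = vertex C i

    S-cycle-w : ∀ i → ¬ Adj G (vertex C i) w
    S-cycle-w i iw = irrefl G (sym (proj₁ (only (i , refl) w∉C iw))) uw

    independent : ¬ EvenlyOriented σ C → LinearlyIndependent (S ∘ ρ)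
    independent ¬even c columns = λ
      { zero → cᵤ≡0 ; (suc zero) → cw≡0 ; (suc (suc i)) → cᵢ≡0 i }
      where
      open ≡-Reasoning

      vanish : ∀ i {x} → ¬ Adj G (ρ i) x → c i * S (ρ i) x ≡ 0ℚ
      vanish i ¬ix = trans (cong (c i *_) (S-nonadj ¬ix)) (ℚ.*-zeroʳ (c i))

      vanish′ : ∀ i {x} → c i ≡ 0ℚ → c i * S (ρ i) x ≡ 0ℚ
      vanish′ i {x} ci≡0 = trans (cong (_* S (ρ i) x) ci≡0) (ℚ.*-zeroˡ (S (ρ i) x))

      cᵤ≡0 : c zero ≡ 0ℚ
      cᵤ≡0 = *S≡0⇒≡0 (c zero) uw (trans (sym (sum-single (λ i → c i * S (ρ i) w) zero λ
        { zero 0≢0 → contradiction refl 0≢0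
        ; (suc zero) _ → vanish (suc zero) (irrefl G refl)
        ; (suc (suc i)) _ → vanish (suc (suc i)) (S-cycle-w i) })) (columns w))

      cᵢ≡0 : ∀ i → c (suc (suc i)) ≡ 0ℚ
      cᵢ≡0 = oddlyOriented⇒kernel-trivial 2∣k ¬even (λ i → c (suc (suc i))) λ j → begin
        R j                                   ≡⟨ trans (ℚ.+-identityˡ _) (ℚ.+-identityˡ _) ⟨
        0ℚ + (0ℚ + R j)                       ≡⟨ cong₂ (λ p q → p + (q + R j)) (vanish′ zero cᵤ≡0)
                                                   (vanish (suc zero) (S-cycle-w j ∘ symm G)) ⟨
        Σℚ (λ i → c i * S (ρ i) (vertex C j)) ≡⟨ columns (vertex C j) ⟩
        0ℚ                                    ∎
        where
        R : Fin (suc m) → ℚ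
        R j = Σℚ (λ i → c (suc (suc i)) * S (vertex C i) (vertex C j))

      cw≡0 : c (suc zero) ≡ 0ℚ
      cw≡0 = *S≡0⇒≡0 (c (suc zero)) (symm G uw) (trans (sym (sum-single (λ i → c i * S (ρ i) u) (suc zero) λ
        { zero _ → vanish′ zero cᵤ≡0
        ; (suc zero) 1≢1 → contradiction refl 1≢1
        ; (suc (suc i)) _ → vanish′ (suc (suc i)) (cᵢ≡0 i) })) (columns u))

-- Distinct rows, parity of the cycle length, and the conclusion

independent⇒distinct : {A : Fin m → Fin n → ℚ} (ρ : Fin s → Fin m) → LinearlyIndependent (A ∘ ρ) →
                       ∀ {i j} → i ≢ j → ρ i ≢ ρ j
independent⇒distinct {s = s} {A} ρ independent {i} {j} i≢j ρi≡ρj =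
  contradiction (trans (sym cᵢ) (independent c columns i)) λ ()
  where
  open ≡-Reasoning

  -- Coefficients of the relation "row i minus row j", which holds because the two rows coincide.
  c : Fin s → ℚ
  c l with l Fin.≟ i | l Fin.≟ j
  ... | yes _ | _     = 1ℚ
  ... | no _  | yes _ = - 1ℚ
  ... | no _  | no _  = 0ℚ

  cᵢ : c i ≡ 1ℚ
  cᵢ with i Fin.≟ i
  ... | yes _  = refl
  ... | no i≢i = contradiction refl i≢i

  cⱼ : c j ≡ - 1ℚ
  cⱼ with j Fin.≟ i | j Fin.≟ j
  ... | yes j≡i | _      = contradiction (sym j≡i) i≢j
  ... | no _    | yes _  = refl
  ... | no _    | no j≢j = contradiction refl j≢j

  c₀ : ∀ l → l ≢ i → l ≢ j → c l ≡ 0ℚ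
  c₀ l l≢i l≢j with l Fin.≟ i | l Fin.≟ j
  ... | yes l≡i | _       = contradiction l≡i l≢i
  ... | no _    | yes l≡j = contradiction l≡j l≢j
  ... | no _    | no _    = refl

  columns : ∀ x → Σℚ (λ l → c l * A (ρ l) x) ≡ 0ℚ
  columns x = begin
    Σℚ (λ l → c l * A (ρ l) x)                 ≡⟨ sum-pair _ i≢j (λ l l≢i l≢j →
                                                    trans (cong (_* A (ρ l) x) (c₀ l l≢i l≢j)) (ℚ.*-zeroˡ (A (ρ l) x))) ⟩
    c i * A (ρ i) x + c j * A (ρ j) x          ≡⟨ cong₂ (λ p q → p * A (ρ i) x + q) cᵢ
                                                    (cong₂ (λ p v → p * A v x) cⱼ (sym ρi≡ρj)) ⟩
    1ℚ * A (ρ i) x + - 1ℚ * A (ρ i) x          ≡⟨ ℚ.*-distribʳ-+ (A (ρ i) x) 1ℚ (- 1ℚ) ⟨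
    0ℚ * A (ρ i) x                             ≡⟨ ℚ.*-zeroˡ (A (ρ i) x) ⟩
    0ℚ                                         ∎

-- For odd `k`, where the rank is `suc k`, this is the inequality `k < n`.
rank≤rows : {A : Fin m → Fin n → ℚ} → Rank A r → r ≤ m
rank≤rows {A = A} ((ρ , independent) , _) = Fin.injective⇒≤ {f = ρ} λ {i} {j} e →
  decidable-stable (i Fin.≟ j) λ i≢j → independent⇒distinct {A = A} ρ independent i≢j e

parity : ∀ m → ∃[ h ] (m ≡ h ℕ.* 2 ⊎ m ≡ suc (h ℕ.* 2))
parity zero    = 0 , inj₁ refl
parity (suc m) with parity m
... | h , inj₁ refl = h , inj₂ refl
... | h , inj₂ refl = suc h , inj₁ refl

2∤1+h*2 : ∀ h → 2 ∤ suc (h ℕ.* 2)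
2∤1+h*2 h (divides q e) = ℕ.even≢odd q h
  (trans (ℕ.*-comm 2 q) (trans (sym e) (cong suc (ℕ.*-comm h 2))))

theorem4p6 : ∀ {n k : ℕ} (G : Graph (Fin n)) (σ : Orientation G) (C : Cycle G k) →
    Connected G →
    IsUniqueCycle C →
    (2 ∣ k → SkewRank σ k) →
    (2 ∤ k → SkewRank σ (suc k)) →
    (∀ v → OnCycle C v → Saturated (treeAt C v) (root C v) →
    IsStar (treeAt C v)
    × (2 ∣ k → MatchingNumber (withoutTreeAt C v) ((k ∸ 2) / 2))
    × (2 ∤ k → MatchingNumber (withoutTreeAt C v) ((k ∸ 1) / 2)))
    ×
    ((∀ v → OnCycle C v → ¬ Saturated (treeAt C v) (root C v)) →
    (2 ∤ k → G ≅ U* k (n ∸ k))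
    × (2 ∣ k → k < n → G ≅ U* k (n ∸ k) × EvenlyOriented σ C))
theorem4p6 {k = zero}  G σ C connected unique _ _ = contradiction (3≤k C) λ ()
theorem4p6 {k = suc m} G σ C connected unique evenRank oddRank with parity m
-- Here `m`, which is `k - 1`, is even, so `k` is odd. The rank `suc k` reduces to `suc h * 2`, and
-- `h` is `(k - 1) / 2`.
... | h , inj₁ refl =
    (λ v v∈C saturated → let x = AtVertex.saturated⇒neighbour v∈C saturated in
        AtVertex.tree-isStar v∈C x
      , (λ 2∣k → contradiction 2∣k odd)
      , λ _ → subst (MatchingNumber _) (sym (m*n/n≡m h 2)) (AtVertex.rest-matchingNumber v∈C x))
  , λ unsaturated →
      (λ _ → attachment⇒U* C unique
        (attachment {h = h} σ C unique rank 2h≤m connected (rank≤rows {A = skewAdjacency σ} rank) unsaturated))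
    , λ 2∣k → contradiction 2∣k odd
  where
  odd  = 2∤1+h*2 h
  rank = oddRank odd
  2h≤m = ℕ.≤-reflexive (ℕ.*-comm 2 h)
  open RankBound {h = h} σ C unique rank 2h≤m
-- Here `k` itself reduces to `suc h * 2`, and `h` is `(k - 2) / 2`. The path left by deleting a
-- cycle vertex has `2h + 1` vertices, so its `h` disjoint edges leave one vertex over.
... | h , inj₂ refl =
    (λ v v∈C saturated → let x = AtVertex.saturated⇒neighbour v∈C saturated in
        AtVertex.tree-isStar v∈C x
      , (λ _ → subst (MatchingNumber _) (sym (m*n/n≡m h 2)) (AtVertex.rest-matchingNumber v∈C x))
      , λ 2∤k → contradiction even 2∤k)
  , λ unsaturated →
      (λ 2∤k → contradiction even 2∤k)
    , λ _ k<n → let att = attachment {h = h} σ C unique rank 2h≤m connected k<n unsaturated in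
        attachment⇒U* C unique att , attachment⇒evenlyOriented σ C unique even rank att
  where
  even = divides (suc h) refl
  rank = evenRank even
  2h≤m = ℕ.m≤n⇒m≤1+n (ℕ.≤-reflexive (ℕ.*-comm 2 h))
  open RankBound {h = h} σ C unique rank 2h≤m
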